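{- Let $S$ be a bounded 4-CSP over $X=\{x_1,\dots,x_n\}$, with solution domain $D_s$ and minimum weight hypergraph $H^s_m$. Then $D_s\neq\emptyset$ if and only if all simple hypercycles of $H^s_m$ are positive.
   Context: $\mathbb{T}$ is $\mathbb{R}$ or $\mathbb{Q}$, $\overline{\mathbb{T}}=\mathbb{T}\cup\{+\infty,-\infty\}$. $X=\{x_1,\dots,x_n\}$ is a set of variables with values in $\mathbb{T}$, $x_0$ is a special variable always equal to $0$, and $X^0=X\cup\{x_0\}$. $e_1,\dots,e_n$ is the standard basis of $\mathbb{T}^n$ and $e_0$ is the zero vector. Canonical 4-constraints: $4\text{ - }\Phi(X^0)$ is the set of inequalities $c_{ijpq}$: $(x_i-x_j)-(x_p-x_q)\le m_{ijpq}$ with $i,j,p,q\in\{0,\dots,n\}$ (repetitions allowed) and $m_{ijpq}\in\mathbb{T}$. The normal vector is $F_v(c_{ijpq})=e_i-e_j-e_p+e_q$, the bound is $F_b(c_{ijpq})=m_{ijpq}$, and the complement is $\overline{c_{ijpq}}=c_{jiqp}$, i.e. $(x_j-x_i)-(x_q-x_p)\le m_{jiqp}$, so $F_v(\overline c)=-F_v(c)$ (only the normal vector of $\overline c$ is used below). A 4-CSP $S$ over $X$ is a finite conjunction of canonical 4-constraints over $X^0$; $C_s$ is the set of these constraints. $D_s$ is the set of valuations $\nu$ (assigning $\nu_i\in\mathbb{T}$ to $x_i$, with $\nu_0=0$) satisfying all constraints of $C_s$. $S$ is bounded if there is $w\in\mathbb{T}$ such that every $\nu\in D_s$ satisfies $-w<\nu_i<w$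 for all $i$. Put $F^s_b(c)=F_b(c)$ if $c\in C_s$ and $F^s_b(c)=+\infty$ otherwise. A family $f=(V_i)_{i\in[1,r]}$ of distinct non-empty (i.e. nonzero) vectors of $\mathbb{T}^n$ is positively dependent if there are $\lambda_i\in\mathbb{N}^{>0}$ with $\sum_{i=1}^r\lambda_iV_i=e_0$, and positively independent otherwise. A positively dependent family is simple if every proper (nonempty) subfamily is positively independent. A set $C=\{c_1,\dots,c_r\}$ of distinct constraints generates a hypercycle (resp. simple hypercycle) if $(F_v(c_i))_{i\in[1,r]}$ is positively dependent (resp. simple positively dependent); the hypercycle is recorded with its coefficients as $(C,(\alpha_i))$, where $\alpha_i\in\mathbb{N}^{>0}$ and $\sum\alpha_iF_v(c_i)=e_0$. For $c\in 4\text{ - }\Phi(X^0)$, the set of hyperpaths of $c$ is $$HPath(c)=\Big\{(P,(\tfrac{\lambda_i}{\lambda})_{i\in[1,r]})\ \Big|\ P=\{c_1,\dots,c_r\}\subseteq 4\text{ - }\Phi(X^0),\ \lambda,\lambda_i\in\mathbb{N}^{>0},\ F_v(\overline c)+\sum_{i=1}^r\tfrac{\lambda_i}{\lambda}F_v(c_i)=e_0\Big\},$$ where the normal vectors of the elements of $P$ are distinct and nonzero. The weight of a hyperpath is $F^s_b((P,(\lambda_i)))=\sum\lambda_iF^s_b(c_i)$. Define $F^s_{bm}(c)=\min\{F^s_b((P,(\lambda_k))) : (P,(\lambda_k))\in HPath(c)\}$, understood as $-\infty$ if this set has no lower bound. The hypergraph $H^s$ associated with $S$ has node set $X^0$, hyperarcs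 given by the constraints, and weight function $F^s_b$. The minimum weight hypergraph $H^s_m$ is the same hypergraph with weight function $w_m(c)=F^s_{bm}(c)$ if $c\in C_s$ and $w_m(c)=+\infty$ otherwise. A hypercycle $(C,(\alpha_i))$ with $C=\{c_1,c_2,\dots\}$ is positive in $H^s_m$ if $\sum\alpha_iw_m(c_i)\ge0$.
   Formalization: Added: every constraint of S with zero normal vector (0 ≤ m) has m ≥ 0; otherwise {x1 ≤ 1, -x1 ≤ 1, 0 ≤ -1} is bounded with D_s empty though all simple hypercycles are positive. T is assumed to have a decidable order, which for the reals is classical. -}

module Defs where

open import Level using (_⊔_) renaming (suc to lsuc)
open import Algebra.Bundles using (CommutativeRing)
open import Algebra.Core using (Op₁; Op₂)
open import Algebra.Morphism.Structures using (module RingMorphisms)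
open import Algebra.Structures using (IsCommutativeRing)
open import Data.Fin.Base using (Fin; zero; suc)
import Data.Fin.Properties as Fin
open import Data.List.Base using (List)
import Data.List.Membership.DecSetoid as DecMembership
open import Data.Nat.Base as ℕ using (ℕ)
open import Data.Product.Base using (_×_; _,_; ∃; proj₁; proj₂)
open import Data.Product.Properties using (≡-dec)
open import Data.Product.Relation.Binary.Pointwise.NonDependent using (×-decSetoid)
open import Data.Rational.Base as ℚ using (ℚ)
open import Data.Sum.Base using (_⊎_)
open import Data.Vec.Functional using (Vector; foldr)
import Data.Vec.Functional.Relation.Binary.Equality.Setoid as VecEquality
open import Function.Base using (_∘_)
open import Function.Definitions using (Injective)
open import Relation.Binary.Bundles using (DecTotalOrder; DecSetoid)
open import Relation.Binary.Core using (Rel)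
open import Relation.Binary.Definitions using (DecidableEquality)
open import Relation.Binary.Morphism.Structures using (IsOrderIsomorphism)
open import Relation.Binary.PropositionalEquality.Core using (_≡_; _≢_)
open import Relation.Binary.PropositionalEquality.Properties as ≡ using ()
open import Relation.Binary.Structures using (IsDecTotalOrder)
import Relation.Binary.Construct.Add.Extrema.Equality as ExtendedEquality
import Relation.Binary.Construct.Add.Extrema.NonStrict as ExtendedOrder
open import Relation.Nullary.Construct.Add.Extrema using (_±; ⊥±; ⊤±; [_])
open import Relation.Nullary.Decidable.Core using (yes; no)
open import Relation.Nullary.Negation.Core using (¬_)
open import Relation.Unary using (Pred; Satisfiable; _∈_)

------------------------------------------------------------------------
-- The scalars

record OrderedField c ℓ₁ ℓ₂ : Set (lsuc (c ⊔ ℓ₁ ⊔ ℓ₂)) where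
  infix  8 _⁻¹
  infix  8 -_
  infixl 7 _*_
  infixl 6 _+_
  infix  4 _≈_ _≤_
  field
    Carrier           : Set c
    _≈_               : Rel Carrier ℓ₁
    _≤_               : Rel Carrier ℓ₂
    _+_ _*_           : Op₂ Carrier
    -_                : Op₁ Carrier
    0# 1#             : Carrier
    -- Total; the value 0# ⁻¹ is left unspecified.
    _⁻¹               : Op₁ Carrier
    isCommutativeRing : IsCommutativeRing _≈_ _+_ _*_ -_ 0# 1#
    isDecTotalOrder   : IsDecTotalOrder _≈_ _≤_
    0≉1               : ¬ (0# ≈ 1#)
    ⁻¹-inverse        : ∀ {x} → ¬ (x ≈ 0#) → x * x ⁻¹ ≈ 1#
    +-mono-≤          : ∀ {x y} z → x ≤ y → x + z ≤ y + z
    *-nonneg          : ∀ {x y} → 0# ≤ x → 0# ≤ y → 0# ≤ x * y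

  commutativeRing : CommutativeRing c ℓ₁
  commutativeRing = record { isCommutativeRing = isCommutativeRing }

  decTotalOrder : DecTotalOrder c ℓ₁ ℓ₂
  decTotalOrder = record { isDecTotalOrder = isDecTotalOrder }

  open CommutativeRing commutativeRing public
    using (_-_; setoid; rawRing; +-rawMonoid)

  open import Relation.Binary.Construct.NonStrictToStrict _≈_ _≤_ public
    using (_<_)

module _ {c ℓ₁ ℓ₂} (T : OrderedField c ℓ₁ ℓ₂) where
  open OrderedField T

  IsUpperBound : ∀ {ℓ} → Pred Carrier ℓ → Pred Carrier _
  IsUpperBound P b = ∀ {x} → x ∈ P → x ≤ b

  IsLeastUpperBound : ∀ {ℓ} → Pred Carrier ℓ → Pred Carrier _
  IsLeastUpperBound P s = s ∈ IsUpperBound P × (∀ {b} → b ∈ IsUpperBound P → s ≤ b)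

  -- Classically, ℝ is the Dedekind-complete ordered field, up to isomorphism.
  IsReal : Set _
  IsReal = (P : Pred Carrier (c ⊔ ℓ₁ ⊔ ℓ₂)) →
           Satisfiable P → Satisfiable (IsUpperBound P) →
           Satisfiable (IsLeastUpperBound P)

  record IsRational : Set (c ⊔ ℓ₁ ⊔ ℓ₂) where
    field
      toℚ                : Carrier → ℚ
      isRingIsomorphism  : RingMorphisms.IsRingIsomorphism rawRing ℚ.+-*-rawRing toℚ
      isOrderIsomorphism : IsOrderIsomorphism _≈_ _≡_ _≤_ ℚ._≤_ toℚ

  IsRealOrRational : Set _
  IsRealOrRational = IsReal ⊎ IsRational

------------------------------------------------------------------------
-- 4-CSPs over x₁, …, xₙ with values in T

module FourCSP {c ℓ₁ ℓ₂} (T : OrderedField c ℓ₁ ℓ₂) (n : ℕ) where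
  open OrderedField T
  open import Algebra.Definitions.RawMonoid +-rawMonoid using (sum)
    renaming (_×_ to _·_)
  open VecEquality setoid using (_≋_)

  ----------------------------------------------------------------------
  -- Arithmetic in T and T ∪ {−∞, +∞}

  fromℕ : ℕ → Carrier
  fromℕ k = k · 1#

  T̄ : Set c
  T̄ = Carrier ±

  open ExtendedEquality _≈_ public using (_≈±_)
  open ExtendedOrder _≤_ public using (_≤±_)

  -- The sum (+∞) + (−∞) is undefined in the source; here +∞ absorbs.
  infixl 6 _+±_
  _+±_ : Op₂ T̄
  ⊤±    +± y     = ⊤±
  x     +± ⊤±    = ⊤±
  ⊥±    +± y     = ⊥±
  x     +± ⊥±    = ⊥±
  [ x ] +± [ y ] = [ x + y ]

  -- Only meaningful for positive scalars, the only ones it is used with.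
  infixr 8 _*±_
  _*±_ : Carrier → T̄ → T̄
  a *± [ x ] = [ a * x ]
  a *± ⊥±    = ⊥±
  a *± ⊤±    = ⊤±

  weightedSum : ∀ {r} → Vector Carrier r → Vector T̄ r → T̄
  weightedSum a w = foldr _+±_ [ 0# ] (λ i → a i *± w i)

  ----------------------------------------------------------------------
  -- Vectors of Tⁿ

  𝟎 : Vector Carrier n
  𝟎 _ = 0#

  -- e zero is the zero vector, and e (suc k) the k-th standard basis vector.
  e : Fin (ℕ.suc n) → Vector Carrier n
  e zero    _ = 0#
  e (suc k) l with k Fin.≟ l
  ... | yes _ = 1#
  ... | no  _ = 0#

  infixl 6 _⊕_
  _⊕_ : Op₂ (Vector Carrier n)
  (u ⊕ v) k = u k + v k

  linearCombination : ∀ {r} → Vector Carrier r → Vector (Vector Carrier n) r →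
                      Vector Carrier n
  linearCombination a V k = sum (λ i → a i * V i k)

  AllPositive : ∀ {r} → Vector ℕ r → Set
  AllPositive α = ∀ i → 0 ℕ.< α i

  DistinctNonzero : ∀ {r} → Vector (Vector Carrier n) r → Set ℓ₁
  DistinctNonzero V = (∀ {i j} → i ≢ j → ¬ (V i ≋ V j)) × (∀ i → ¬ (V i ≋ 𝟎))

  PositivelyDependent : ∀ {r} → Vector (Vector Carrier n) r → Set ℓ₁
  PositivelyDependent {r} V =
    ∃ λ (α : Vector ℕ r) → AllPositive α × linearCombination (fromℕ ∘ α) V ≋ 𝟎

  PositivelyIndependent : ∀ {r} → Vector (Vector Carrier n) r → Set ℓ₁
  PositivelyIndependent V = ¬ PositivelyDependent V

  -- Proper nonempty subfamilies are given by injective reindexings V ∘ ι.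
  ProperSubfamiliesIndependent : ∀ {r} → Vector (Vector Carrier n) r → Set ℓ₁
  ProperSubfamiliesIndependent {r} V =
    ∀ {s} (ι : Fin s → Fin r) → Injective _≡_ _≡_ ι → 0 ℕ.< s → s ℕ.< r →
    PositivelyIndependent (V ∘ ι)

  ----------------------------------------------------------------------
  -- Constraints

  X⁰ : Set
  X⁰ = Fin (ℕ.suc n)

  Shape : Set
  Shape = X⁰ × X⁰ × X⁰ × X⁰

  -- ((i , j , p , q) , m) is the inequality (xᵢ − xⱼ) − (xₚ − x_q) ≤ m.
  Constraint : Set c
  Constraint = Shape × Carrier

  shape : Constraint → Shape
  shape = proj₁

  bound : Constraint → Carrier
  bound = proj₂

  normalVector : Shape → Vector Carrier n
  normalVector (i , j , p , q) k = e i k - e j k - e p k + e q k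

  F-v : Constraint → Vector Carrier n
  F-v = normalVector ∘ shape

  -- Only the normal vector of a complement is ever used, so complements are
  -- taken at the level of shapes, without a bound.
  complement : Shape → Shape
  complement (i , j , p , q) = (j , i , q , p)

  _≟-Shape_ : DecidableEquality Shape
  _≟-Shape_ = ≡-dec Fin._≟_ (≡-dec Fin._≟_ (≡-dec Fin._≟_ Fin._≟_))

  constraintDecSetoid : DecSetoid c ℓ₁
  constraintDecSetoid =
    ×-decSetoid (≡.decSetoid _≟-Shape_) (DecTotalOrder.Eq.decSetoid decTotalOrder)

  open DecMembership constraintDecSetoid public
    using () renaming (_∈_ to _∈ᶜ_; _∉_ to _∉ᶜ_; _∈?_ to _∈ᶜ?_)

  ----------------------------------------------------------------------
  -- 4-CSPs

  4-CSP : Set c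
  4-CSP = List Constraint

  Valuation : Set c
  Valuation = Vector Carrier n

  value : Valuation → X⁰ → Carrier
  value ν zero    = 0#
  value ν (suc k) = ν k

  Satisfies : Valuation → Constraint → Set ℓ₂
  Satisfies ν ((i , j , p , q) , m) =
    (value ν i - value ν j) - (value ν p - value ν q) ≤ m

  D : 4-CSP → Pred Valuation (c ⊔ ℓ₁ ⊔ ℓ₂)
  D S ν = ∀ {c} → c ∈ᶜ S → Satisfies ν c

  Bounded : 4-CSP → Set (c ⊔ ℓ₁ ⊔ ℓ₂)
  Bounded S = ∃ λ w → ∀ {ν} → ν ∈ D S → ∀ k → (- w < ν k) × (ν k < w)

  -- A constraint with zero normal vector reads 0 ≤ m.  It occurs in no
  -- hypercycle and in no hyperpath, so when m < 0 it empties D S unseen by the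
  -- hypergraph; this condition rules that out.
  DegenerateConstraintsHold : 4-CSP → Set (c ⊔ ℓ₁ ⊔ ℓ₂)
  DegenerateConstraintsHold S = ∀ {c} → c ∈ᶜ S → F-v c ≋ 𝟎 → 0# ≤ bound c

  F-b : 4-CSP → Constraint → T̄
  F-b S c with c ∈ᶜ? S
  ... | yes _ = [ bound c ]
  ... | no  _ = ⊤±

  ----------------------------------------------------------------------
  -- Hyperpaths and hypercycles

  record HyperPath (c₀ : Constraint) : Set (c ⊔ ℓ₁) where
    field
      {r}         : ℕ
      r>0         : 0 ℕ.< r
      path        : Vector Constraint r
      distinct    : DistinctNonzero (F-v ∘ path)
      denominator : ℕ
      numerator   : Vector ℕ r
      denominator-positive : 0 ℕ.< denominator
      numerator-positive   : AllPositive numerator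

    coefficient : Vector Carrier r
    coefficient i = fromℕ (numerator i) * fromℕ denominator ⁻¹

    field
      balanced : normalVector (complement (shape c₀)) ⊕
                 linearCombination coefficient (F-v ∘ path) ≋ 𝟎

  pathWeight : (S : 4-CSP) {c : Constraint} → HyperPath c → T̄
  pathWeight S p = weightedSum coefficient (F-b S ∘ path)
    where open HyperPath p

  record HyperCycle : Set (c ⊔ ℓ₁) where
    field
      {r}         : ℕ
      r>0         : 0 ℕ.< r
      constraints : Vector Constraint r
      distinct    : DistinctNonzero (F-v ∘ constraints)
      α           : Vector ℕ r
      α-positive  : AllPositive α
      balanced    : linearCombination (fromℕ ∘ α) (F-v ∘ constraints) ≋ 𝟎

  IsSimple : HyperCycle → Set ℓ₁
  IsSimple C = ProperSubfamiliesIndependent (F-v ∘ constraints)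
    where open HyperCycle C

  ----------------------------------------------------------------------
  -- The minimum weight hypergraph

  -- Minimum P v : v is the minimum of P, understood as −∞ if P has no lower
  -- bound in T.
  data Minimum {ℓ} (P : Pred T̄ ℓ) : T̄ → Set (c ⊔ ℓ₁ ⊔ ℓ₂ ⊔ ℓ) where
    attained  : ∀ {v} → v ∈ P → (∀ {u} → u ∈ P → v ≤± u) → Minimum P v
    unbounded : ¬ (∃ λ b → ∀ {u} → u ∈ P → [ b ] ≤± u) → Minimum P ⊥±

  PathWeights : 4-CSP → Constraint → Pred T̄ (c ⊔ ℓ₁)
  PathWeights S c v = ∃ λ (p : HyperPath c) → pathWeight S p ≈± v

  -- The graph of the function F_bm, whose values cannot be computed by cases
  -- constructively.
  F-bm : 4-CSP → Constraint → Pred T̄ (c ⊔ ℓ₁ ⊔ ℓ₂)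
  F-bm S c = Minimum (PathWeights S c)

  -- The graph of the weight function of the minimum weight hypergraph.
  data MinWeight (S : 4-CSP) (c₀ : Constraint) : Pred T̄ (c ⊔ ℓ₁ ⊔ ℓ₂) where
    inside  : ∀ {v} → c₀ ∈ᶜ S → F-bm S c₀ v → MinWeight S c₀ v
    outside : c₀ ∉ᶜ S → MinWeight S c₀ ⊤±

  -- The weights are required to exist, so positivity is never vacuous.
  IsPositive : 4-CSP → HyperCycle → Set (c ⊔ ℓ₁ ⊔ ℓ₂)
  IsPositive S C =
    ∃ λ (w : Vector T̄ r) → (∀ i → MinWeight S (constraints i) (w i)) ×
                           [ 0# ] ≤± weightedSum (fromℕ ∘ α) w
    where open HyperCycle C

{-# OPTIONS --safe #-}
module Submission where

-- If ν solves S, then along a hyperpath of c the weighted bounds sum to at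
-- least F_v(c)·ν, and around a hypercycle the numbers F_v(cᵢ)·ν cancel; hence
-- minimum weights exist and sum to a nonnegative number.  The minimum is
-- attained at a hyperpath with rational coefficients because Fourier–Motzkin
-- elimination, run on integer rows, only ever multiplies by natural numbers:
-- it computes the best upper bound for F_v(c)·ν on D S together with a
-- certificate, and that certificate is the hyperpath.
--
-- Conversely, elimination either solves S or returns a positive dependence of
-- normal vectors with negative weight.  Any proper dependent subfamily either
-- has negative weight itself or can be subtracted until the support shrinks
-- with the weight staying negative, so a smallest such dependence is a simple
-- hypercycle.  Since every constraint is a hyperpath of itself, minimum
-- weights never exceed bounds and that hypercycle is not positive.

import Level
open import Defs
open import Algebra.Bundles using (CommutativeRing)
open import Data.Empty using (⊥-elim)
open import Data.Fin.Base using (Fin; zero; suc; combine; remQuot)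
import Data.Fin.Properties as Fin
open import Data.List.Base using ([]; _∷_)
open import Data.List.Relation.Unary.Any using (here; there)
open import Data.Nat.Base as ℕ using (ℕ; zero; suc; z≤n; s≤s)
import Data.Nat.Properties as ℕ
open import Data.Product.Base using (_×_; _,_; ∃; proj₁; proj₂)
open import Data.Sum.Base as Sum using (_⊎_; inj₁; inj₂; [_,_]′)
open import Data.Unit.Base using (tt)
open import Data.Vec.Functional as Vector using (Vector)
open import Function.Base using (_∘_)
open import Function.Bundles using (_⇔_; mk⇔)
open import Function.Definitions using (Injective)
open import Relation.Binary.Bundles using (DecTotalOrder)
import Relation.Binary.Construct.Add.Extrema.Equality as ExtendedEquality
import Relation.Binary.Construct.Add.Extrema.NonStrict as ExtendedOrder
import Relation.Binary.Construct.Add.Supremum.NonStrict as AddSupremum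
open import Relation.Binary.PropositionalEquality.Core as ≡ using (_≡_; _≢_)
open import Relation.Nullary.Construct.Add.Extrema using (⊥±; ⊤±; [_])
open import Relation.Nullary.Decidable.Core using (Dec; yes; no; decidable-stable)
open import Relation.Nullary.Negation.Core using (¬_)
open import Relation.Unary using (Satisfiable)

-- Arithmetic of ordered fields

module OrderedFieldProperties {c ℓ₁ ℓ₂} (T : OrderedField c ℓ₁ ℓ₂) where
  open OrderedField T public
  open CommutativeRing commutativeRing public
    using (refl; sym; trans; reflexive; +-cong; +-congˡ; +-congʳ; +-assoc; +-comm;
           +-identityˡ; +-identityʳ; -‿cong; -‿inverseˡ; -‿inverseʳ;
           *-cong; *-congˡ; *-congʳ; *-assoc; *-comm; *-identityˡ; *-identityʳ;
           zeroˡ; zeroʳ; distribˡ; distribʳ; commutativeSemiring; semiring; ring)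
  open DecTotalOrder decTotalOrder public
    using (_≟_; _≤?_; total; antisym; ≤-respˡ-≈; ≤-respʳ-≈)
    renaming (refl to ≤-refl; trans to ≤-trans; reflexive to ≤-reflexive)
  open import Algebra.Definitions.RawMonoid +-rawMonoid public using (sum)
    renaming (_×_ to _·_)
  open import Algebra.Properties.Ring ring public
    using (-‿distribˡ-*; -‿distribʳ-*; -0#≈0#; -‿involutive; -‿+-comm)
  open import Algebra.Properties.Semiring.Mult semiring using (×-homo-+; ×1-homo-*)
  open import Algebra.Properties.Semiring.Sum semiring public
    using (∑-comm; ∑-distrib-+; *-distribˡ-sum; *-distribʳ-sum; sum-cong-≋)
  open import Algebra.Solver.Ring.NaturalCoefficients.Default commutativeSemiring public
    using (solve; _:+_; _:*_; _:=_)
  open import Relation.Binary.Construct.NonStrictToStrict _≈_ _≤_ using (<-decidable)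
  open import Relation.Binary.Reasoning.Setoid setoid

  infix 4 _≉_ _<?_
  _≉_ : Carrier → Carrier → Set _
  x ≉ y = ¬ (x ≈ y)

  _<?_ : ∀ x y → Dec (x < y)
  _<?_ = <-decidable _≟_ _≤?_

  +-mono₂-≤ : ∀ {x y u v} → x ≤ y → u ≤ v → x + u ≤ y + v
  +-mono₂-≤ {x} {y} {u} {v} x≤y u≤v = ≤-trans (+-mono-≤ u x≤y)
    (≤-respˡ-≈ (+-comm u y) (≤-respʳ-≈ (+-comm v y) (+-mono-≤ y u≤v)))

  +-nonneg : ∀ {x y} → 0# ≤ x → 0# ≤ y → 0# ≤ x + y
  +-nonneg 0≤x 0≤y = ≤-respˡ-≈ (+-identityˡ 0#) (+-mono₂-≤ 0≤x 0≤y)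

  x+[-x+y]≈y : ∀ x y → x + (- x + y) ≈ y
  x+[-x+y]≈y x y = begin
    x + (- x + y) ≈⟨ +-assoc x (- x) y ⟨
    x + - x + y   ≈⟨ +-congʳ (-‿inverseʳ x) ⟩
    0# + y        ≈⟨ +-identityˡ y ⟩
    y             ∎

  +-cancelˡ-≤ : ∀ x {y z} → x + y ≤ x + z → y ≤ z
  +-cancelˡ-≤ x {y} {z} p = ≤-respˡ-≈ (cancel y) (≤-respʳ-≈ (cancel z) (+-mono₂-≤ (≤-refl {x = - x}) p))
    where
    cancel : ∀ u → - x + (x + u) ≈ u
    cancel u = trans (sym (+-assoc (- x) x u)) (trans (+-congʳ (-‿inverseˡ x)) (+-identityˡ u))

  x≤y⇒0≤y-x : ∀ {x y} → x ≤ y → 0# ≤ y - x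
  x≤y⇒0≤y-x {x} p = ≤-respˡ-≈ (-‿inverseʳ x) (+-mono-≤ (- x) p)

  0≤y-x⇒x≤y : ∀ {x y} → 0# ≤ y - x → x ≤ y
  0≤y-x⇒x≤y {x} {y} p = ≤-respˡ-≈ (+-identityʳ x)
    (≤-respʳ-≈ (trans (+-congˡ (+-comm y (- x))) (x+[-x+y]≈y x y)) (+-mono₂-≤ (≤-refl {x = x}) p))

  neg-antimono-≤ : ∀ {x y} → x ≤ y → - y ≤ - x
  neg-antimono-≤ {x} {y} x≤y = 0≤y-x⇒x≤y
    (≤-respʳ-≈ (trans (+-comm y (- x)) (+-congˡ (sym (-‿involutive y)))) (x≤y⇒0≤y-x x≤y))

  x≤0⇒0≤-x : ∀ {x} → x ≤ 0# → 0# ≤ - x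
  x≤0⇒0≤-x p = ≤-respˡ-≈ -0#≈0# (neg-antimono-≤ p)

  0<⇒≯ : ∀ {x} → 0# < x → ¬ (0# < - x)
  0<⇒≯ (0≤x , _) (0≤-x , 0≉-x) = 0≉-x (antisym 0≤-x (≤-respʳ-≈ -0#≈0# (neg-antimono-≤ 0≤x)))

  *-monoˡ-≤ : ∀ {a x y} → 0# ≤ a → x ≤ y → a * x ≤ a * y
  *-monoˡ-≤ {a} {x} {y} 0≤a x≤y = 0≤y-x⇒x≤y
    (≤-respʳ-≈ (trans (distribˡ a y (- x)) (+-congˡ (sym (-‿distribʳ-* a x))))
      (*-nonneg 0≤a (x≤y⇒0≤y-x x≤y)))

  0≤1 : 0# ≤ 1#
  0≤1 with total 0# 1#
  ... | inj₁ p = p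
  -- If 1 were nonpositive, -1 would be nonnegative, and so would its square, which is 1.
  ... | inj₂ p = ≤-respʳ-≈ square (*-nonneg (x≤0⇒0≤-x p) (x≤0⇒0≤-x p))
    where
    square : - 1# * - 1# ≈ 1#
    square = trans (sym (-‿distribˡ-* 1# (- 1#))) (trans (-‿cong (*-identityˡ (- 1#))) (-‿involutive 1#))

  1≰0 : ¬ (1# ≤ 0#)
  1≰0 p = 0≉1 (antisym 0≤1 p)

  ≰⇒≥ : ∀ {x y} → ¬ (x ≤ y) → y ≤ x
  ≰⇒≥ {x} {y} x≰y = [ (λ p → ⊥-elim (x≰y p)) , (λ p → p) ]′ (total x y)

  0<⇒≉ : ∀ {x} → 0# < x → x ≉ 0#
  0<⇒≉ (_ , 0≉x) x≈0 = 0≉x (sym x≈0)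

  ⁻¹-inverseˡ : ∀ {x} → x ≉ 0# → x ⁻¹ * x ≈ 1#
  ⁻¹-inverseˡ {x} x≉0 = trans (*-comm (x ⁻¹) x) (⁻¹-inverse x≉0)

  ⁻¹-nonneg : ∀ {x} → 0# < x → 0# ≤ x ⁻¹
  ⁻¹-nonneg {x} 0<x with total 0# (x ⁻¹)
  ... | inj₁ p = p
  ... | inj₂ p = ⊥-elim (1≰0 (≤-respˡ-≈ (-‿involutive 1#) (≤-respʳ-≈ -0#≈0# (neg-antimono-≤
        (≤-respʳ-≈ (trans (sym (-‿distribʳ-* x (x ⁻¹))) (-‿cong (⁻¹-inverse (0<⇒≉ 0<x))))
          (*-nonneg (proj₁ 0<x) (x≤0⇒0≤-x p)))))))

  a⁻¹[ax]≈x : ∀ {a} → a ≉ 0# → ∀ x → a ⁻¹ * (a * x) ≈ x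
  a⁻¹[ax]≈x {a} a≉0 x = begin
    a ⁻¹ * (a * x) ≈⟨ *-assoc (a ⁻¹) a x ⟨
    a ⁻¹ * a * x   ≈⟨ *-congʳ (⁻¹-inverseˡ a≉0) ⟩
    1# * x         ≈⟨ *-identityˡ x ⟩
    x              ∎

  ⁻¹-cong : ∀ {x y} → x ≉ 0# → x ≈ y → x ⁻¹ ≈ y ⁻¹
  ⁻¹-cong {x} {y} x≉0 x≈y = begin
    x ⁻¹              ≈⟨ *-identityʳ (x ⁻¹) ⟨
    x ⁻¹ * 1#         ≈⟨ *-congˡ (⁻¹-inverse (λ y≈0 → x≉0 (trans x≈y y≈0))) ⟨
    x ⁻¹ * (y * y ⁻¹) ≈⟨ *-congˡ (*-congʳ x≈y) ⟨
    x ⁻¹ * (x * y ⁻¹) ≈⟨ a⁻¹[ax]≈x x≉0 (y ⁻¹) ⟩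
    y ⁻¹              ∎

  a[a⁻¹x]≈x : ∀ {a} → a ≉ 0# → ∀ x → a * (a ⁻¹ * x) ≈ x
  a[a⁻¹x]≈x {a} a≉0 x = begin
    a * (a ⁻¹ * x) ≈⟨ *-assoc a (a ⁻¹) x ⟨
    a * a ⁻¹ * x   ≈⟨ *-congʳ (⁻¹-inverse a≉0) ⟩
    1# * x         ≈⟨ *-identityˡ x ⟩
    x              ∎

  *-cancelˡ-nonneg : ∀ {a x} → 0# < a → 0# ≤ a * x → 0# ≤ x
  *-cancelˡ-nonneg {a} {x} 0<a p =
    ≤-respʳ-≈ (a⁻¹[ax]≈x (0<⇒≉ 0<a) x) (*-nonneg (⁻¹-nonneg 0<a) p)

  -- Natural and integer elements of the field

  fromℕ : ℕ → Carrier
  fromℕ k = k · 1#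

  fromℕ-nonneg : ∀ k → 0# ≤ fromℕ k
  fromℕ-nonneg zero    = ≤-refl
  fromℕ-nonneg (suc k) = +-nonneg 0≤1 (fromℕ-nonneg k)

  fromℕ-positive : ∀ {k} → 0 ℕ.< k → 0# < fromℕ k
  fromℕ-positive {suc k} _ = fromℕ-nonneg (suc k) , λ 0≈1+k → 1≰0
    (≤-respʳ-≈ (sym 0≈1+k) (≤-respˡ-≈ (+-identityʳ 1#) (+-mono₂-≤ ≤-refl (fromℕ-nonneg k))))

  fromℕ-+ : ∀ m n → fromℕ (m ℕ.+ n) ≈ fromℕ m + fromℕ n
  fromℕ-+ = ×-homo-+ 1#

  fromℕ-* : ∀ m n → fromℕ (m ℕ.* n) ≈ fromℕ m * fromℕ n
  fromℕ-* = ×1-homo-*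

  -- Integrality is a predicate on field elements, so elimination can compute in the field and
  -- natural coefficients are read off only at the end.
  IsNat : Carrier → Set _
  IsNat x = ∃ λ k → x ≈ fromℕ k

  -- An integer is given as a difference of two naturals, with the subtracted one moved to the left
  -- side so that only sums occur.
  IsInt : Carrier → Set _
  IsInt x = ∃ λ k → ∃ λ l → x + fromℕ l ≈ fromℕ k

  IsNat⇒nonneg : ∀ {x} → IsNat x → 0# ≤ x
  IsNat⇒nonneg (k , x≈k) = ≤-respʳ-≈ (sym x≈k) (fromℕ-nonneg k)

  IsNat⇒IsInt : ∀ {x} → IsNat x → IsInt x
  IsNat⇒IsInt (k , x≈k) = k , 0 , trans (+-identityʳ _) x≈k

  0-isNat : IsNat 0#
  0-isNat = 0 , refl

  1-isNat : IsNat 1#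
  1-isNat = 1 , sym (+-identityʳ 1#)

  +-isNat : ∀ {x y} → IsNat x → IsNat y → IsNat (x + y)
  +-isNat (k , p) (l , q) = k ℕ.+ l , trans (+-cong p q) (sym (fromℕ-+ k l))

  *-isNat : ∀ {x y} → IsNat x → IsNat y → IsNat (x * y)
  *-isNat (k , p) (l , q) = k ℕ.* l , trans (*-cong p q) (sym (fromℕ-* k l))

  +-isInt : ∀ {x y} → IsInt x → IsInt y → IsInt (x + y)
  +-isInt {x} {y} (k , l , p) (k′ , l′ , q) = k ℕ.+ k′ , l ℕ.+ l′ , (begin
    x + y + fromℕ (l ℕ.+ l′)        ≈⟨ +-congˡ (fromℕ-+ l l′) ⟩
    x + y + (fromℕ l + fromℕ l′)    ≈⟨ solve 4 (λ a b c d → a :+ b :+ (c :+ d) := (a :+ c) :+ (b :+ d)) refl x y (fromℕ l) (fromℕ l′) ⟩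
    (x + fromℕ l) + (y + fromℕ l′)  ≈⟨ +-cong p q ⟩
    fromℕ k + fromℕ k′              ≈⟨ fromℕ-+ k k′ ⟨
    fromℕ (k ℕ.+ k′)                ∎)

  neg-isInt : ∀ {x} → IsInt x → IsInt (- x)
  neg-isInt {x} (k , l , p) = l , k , (begin
    - x + fromℕ k        ≈⟨ +-congˡ p ⟨
    - x + (x + fromℕ l)  ≈⟨ +-assoc (- x) x (fromℕ l) ⟨
    - x + x + fromℕ l    ≈⟨ +-congʳ (-‿inverseˡ x) ⟩
    0# + fromℕ l         ≈⟨ +-identityˡ (fromℕ l) ⟩
    fromℕ l              ∎)

  *-isInt : ∀ {x y} → IsNat x → IsInt y → IsInt (x * y)
  *-isInt {x} {y} (m , r) (k , l , p) = m ℕ.* k , m ℕ.* l , (begin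
    x * y + fromℕ (m ℕ.* l)               ≈⟨ +-cong (*-congʳ r) (fromℕ-* m l) ⟩
    fromℕ m * y + fromℕ m * fromℕ l       ≈⟨ distribˡ (fromℕ m) y (fromℕ l) ⟨
    fromℕ m * (y + fromℕ l)               ≈⟨ *-congˡ p ⟩
    fromℕ m * fromℕ k                     ≈⟨ fromℕ-* m k ⟨
    fromℕ (m ℕ.* k)                       ∎)

  -- With `x` equal to `k` minus `l`, either `l` is at most `k` and truncated subtraction is exact,
  -- or `x` is at most 0 and hence equal to 0.
  IsInt∧nonneg⇒IsNat : ∀ {x} → IsInt x → 0# ≤ x → IsNat x
  IsInt∧nonneg⇒IsNat {x} (k , l , p) 0≤x with ℕ.≤-total l k
  ... | inj₁ l≤k = k ℕ.∸ l , (begin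
    x                                            ≈⟨ x+[-x+y]≈y (fromℕ l) x ⟨
    fromℕ l + (- fromℕ l + x)                    ≈⟨ solve 3 (λ a b c → a :+ (b :+ c) := b :+ (c :+ a)) refl (fromℕ l) (- fromℕ l) x ⟩
    - fromℕ l + (x + fromℕ l)                    ≈⟨ +-congˡ p ⟩
    - fromℕ l + fromℕ k                          ≈⟨ +-congˡ (trans (reflexive (≡.cong fromℕ (≡.sym (ℕ.m+[n∸m]≡n l≤k)))) (fromℕ-+ l (k ℕ.∸ l))) ⟩
    - fromℕ l + (fromℕ l + fromℕ (k ℕ.∸ l))      ≈⟨ solve 3 (λ a b c → a :+ (b :+ c) := b :+ (a :+ c)) refl (- fromℕ l) (fromℕ l) (fromℕ (k ℕ.∸ l)) ⟩
    fromℕ l + (- fromℕ l + fromℕ (k ℕ.∸ l))      ≈⟨ x+[-x+y]≈y (fromℕ l) _ ⟩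
    fromℕ (k ℕ.∸ l)                              ∎)
  ... | inj₂ k≤l = 0 , antisym (+-cancelˡ-≤ (fromℕ l)
    (≤-respˡ-≈ (trans (sym p) (+-comm x _)) (≤-respʳ-≈ (sym (+-identityʳ _)) fromℕk≤fromℕl))) 0≤x
    where
    fromℕk≤fromℕl : fromℕ k ≤ fromℕ l
    fromℕk≤fromℕl = ≤-respʳ-≈ (trans (sym (fromℕ-+ k (l ℕ.∸ k))) (reflexive (≡.cong fromℕ (ℕ.m+[n∸m]≡n k≤l))))
      (≤-respˡ-≈ (+-identityʳ _) (+-mono₂-≤ ≤-refl (fromℕ-nonneg (l ℕ.∸ k))))

  -- Each nonzero case carries the absolute value as a natural number, since these absolute values
  -- become the multipliers of elimination.
  data Sign (x : Carrier) : Set (c Level.⊔ ℓ₁ Level.⊔ ℓ₂) where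
    sign₀ : x ≈ 0# → Sign x
    sign₊ : IsNat x → 0# < x → Sign x
    sign₋ : IsNat (- x) → 0# < - x → Sign x

  sign : ∀ {x} → IsInt x → Sign x
  sign {x} x-int with x ≟ 0# | 0# ≤? x
  ... | yes x≈0 | _ = sign₀ x≈0
  ... | no x≉0 | yes 0≤x = sign₊ (IsInt∧nonneg⇒IsNat x-int 0≤x) (0≤x , x≉0 ∘ sym)
  ... | no x≉0 | no 0≰x = sign₋ (IsInt∧nonneg⇒IsNat (neg-isInt x-int) 0≤-x)
                              (0≤-x , λ 0≈-x → x≉0 (trans (sym (-‿involutive x)) (trans (-‿cong (sym 0≈-x)) -0#≈0#)))
    where 0≤-x = x≤0⇒0≤-x (≰⇒≥ 0≰x)

  -- Dot products, unit vectors and finite minima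

  dot : ∀ {n} → Vector Carrier n → Vector Carrier n → Carrier
  dot a f = sum (λ i → a i * f i)

  dot-congˡ : ∀ {n} {a a′ : Vector Carrier n} (f : Vector Carrier n) →
              (∀ i → a i ≈ a′ i) → dot a f ≈ dot a′ f
  dot-congˡ f p = sum-cong-≋ (λ i → *-congʳ (p i))

  dot-empty : ∀ {n} → n ≡ 0 → (a f : Vector Carrier n) → dot a f ≈ 0#
  dot-empty ≡.refl a f = refl

  dot-zeroˡ : ∀ {n} {a : Vector Carrier n} f → (∀ i → a i ≈ 0#) → dot a f ≈ 0#
  dot-zeroˡ {zero}  f p = refl
  dot-zeroˡ {suc n} f p = trans (+-cong (trans (*-congʳ (p zero)) (zeroˡ _)) (dot-zeroˡ (f ∘ suc) (p ∘ suc))) (+-identityˡ 0#)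

  dot-comm : ∀ {n} (a f : Vector Carrier n) → dot a f ≈ dot f a
  dot-comm a f = sum-cong-≋ (λ i → *-comm (a i) (f i))

  dot-zeroʳ : ∀ {n} a {f : Vector Carrier n} → (∀ i → f i ≈ 0#) → dot a f ≈ 0#
  dot-zeroʳ a {f} p = trans (dot-comm a f) (dot-zeroˡ a p)

  dot-+ʳ : ∀ {n} (a f g : Vector Carrier n) → dot a (λ i → f i + g i) ≈ dot a f + dot a g
  dot-+ʳ a f g = trans (sum-cong-≋ (λ i → distribˡ (a i) (f i) (g i)))
                       (∑-distrib-+ (λ i → a i * f i) (λ i → a i * g i))

  dot-+ˡ : ∀ {n} (a b f : Vector Carrier n) → dot (λ i → a i + b i) f ≈ dot a f + dot b f
  dot-+ˡ a b f = trans (dot-comm _ f) (trans (dot-+ʳ f a b) (+-cong (dot-comm f a) (dot-comm f b)))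

  dot-*ˡ : ∀ {n} k (a f : Vector Carrier n) → dot (λ i → k * a i) f ≈ k * dot a f
  dot-*ˡ k a f = trans (sum-cong-≋ (λ i → *-assoc k (a i) (f i)))
                       (sym (*-distribˡ-sum k (λ i → a i * f i)))

  dot-negˡ : ∀ {n} (a f : Vector Carrier n) → dot (λ i → - a i) f ≈ - dot a f
  dot-negˡ {zero}  a f = sym -0#≈0#
  dot-negˡ {suc n} a f = trans (+-cong (sym (-‿distribˡ-* _ _)) (dot-negˡ (a ∘ suc) (f ∘ suc))) (-‿+-comm _ _)

  dot-negʳ : ∀ {n} (a f : Vector Carrier n) → dot a (λ i → - f i) ≈ - dot a f
  dot-negʳ a f = trans (dot-comm a _) (trans (dot-negˡ f a) (-‿cong (dot-comm f a)))

  -- This is associativity of a row vector, a matrix and a column vector. It turns a combination of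
  -- inequalities into one inequality with combined coefficients.
  dot-assoc : ∀ {m n} (a : Vector Carrier m) (E : Fin m → Fin n → Carrier) (f : Vector Carrier n) →
              dot a (λ j → dot (E j) f) ≈ dot (λ i → dot a (λ j → E j i)) f
  dot-assoc a E f = begin
    sum (λ j → a j * sum (λ i → E j i * f i))    ≈⟨ sum-cong-≋ (λ j → *-distribˡ-sum (a j) (λ i → E j i * f i)) ⟩
    sum (λ j → sum (λ i → a j * (E j i * f i)))  ≈⟨ ∑-comm (λ j i → a j * (E j i * f i)) ⟩
    sum (λ i → sum (λ j → a j * (E j i * f i)))  ≈⟨ sum-cong-≋ (λ i → sum-cong-≋ (λ j → *-assoc (a j) (E j i) (f i))) ⟨
    sum (λ i → sum (λ j → a j * E j i * f i))    ≈⟨ sum-cong-≋ (λ i → *-distribʳ-sum (f i) (λ j → a j * E j i)) ⟨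
    sum (λ i → sum (λ j → a j * E j i) * f i)    ∎

  dot-monoʳ-≤ : ∀ {n} {a f g : Vector Carrier n} →
                (∀ i → 0# ≤ a i) → (∀ i → f i ≤ g i) → dot a f ≤ dot a g
  dot-monoʳ-≤ {zero}  p q = ≤-refl
  dot-monoʳ-≤ {suc n} p q = +-mono₂-≤ (*-monoˡ-≤ (p zero) (q zero)) (dot-monoʳ-≤ (p ∘ suc) (q ∘ suc))

  dot-isInt : ∀ {n} {a f : Vector Carrier n} → (∀ i → IsNat (a i)) → (∀ i → IsInt (f i)) → IsInt (dot a f)
  dot-isInt {zero}  p q = IsNat⇒IsInt 0-isNat
  dot-isInt {suc n} p q = +-isInt (*-isInt (p zero) (q zero)) (dot-isInt (p ∘ suc) (q ∘ suc))

  dot-isNat : ∀ {n} {a f : Vector Carrier n} → (∀ i → IsNat (a i)) → (∀ i → IsNat (f i)) → IsNat (dot a f)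
  dot-isNat {zero}  p q = 0-isNat
  dot-isNat {suc n} p q = +-isNat (*-isNat (p zero) (q zero)) (dot-isNat (p ∘ suc) (q ∘ suc))

  δ : ∀ {n} → Fin n → Vector Carrier n
  δ zero    zero    = 1#
  δ zero    (suc j) = 0#
  δ (suc i) zero    = 0#
  δ (suc i) (suc j) = δ i j

  δ-isNat : ∀ {n} (i j : Fin n) → IsNat (δ i j)
  δ-isNat zero    zero    = 1-isNat
  δ-isNat zero    (suc j) = 0-isNat
  δ-isNat (suc i) zero    = 0-isNat
  δ-isNat (suc i) (suc j) = δ-isNat i j

  δ-diagonal : ∀ {n} (i : Fin n) → δ i i ≡ 1#
  δ-diagonal zero    = ≡.refl
  δ-diagonal (suc i) = δ-diagonal i

  δ-offDiagonal : ∀ {n} {i j : Fin n} → i ≢ j → δ i j ≡ 0#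
  δ-offDiagonal {i = zero}  {zero}  i≢j = ⊥-elim (i≢j ≡.refl)
  δ-offDiagonal {i = zero}  {suc j} i≢j = ≡.refl
  δ-offDiagonal {i = suc i} {zero}  i≢j = ≡.refl
  δ-offDiagonal {i = suc i} {suc j} i≢j = δ-offDiagonal (i≢j ∘ ≡.cong suc)

  dot-δ : ∀ {n} (i : Fin n) f → dot (δ i) f ≈ f i
  dot-δ zero    f = trans (+-cong (*-identityˡ _) (dot-zeroˡ (f ∘ suc) (λ _ → refl))) (+-identityʳ _)
  dot-δ (suc i) f = trans (+-cong (zeroˡ _) (dot-δ i (f ∘ suc))) (+-identityˡ _)

  argmin : ∀ {n p} {P : Fin n → Set p} → (∀ i → Dec (P i)) → (f : Vector Carrier n) →
           (∀ i → ¬ P i) ⊎ (∃ λ i → P i × (∀ j → P j → f i ≤ f j))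
  argmin {zero}  P? f = inj₁ λ ()
  argmin {suc n} P? f with P? zero | argmin (P? ∘ suc) (f ∘ suc)
  ... | no ¬p | inj₁ none = inj₁ λ { zero → ¬p ; (suc i) → none i }
  ... | no ¬p | inj₂ (i , pi , min) = inj₂ (suc i , pi , λ { zero p → ⊥-elim (¬p p) ; (suc j) → min j })
  ... | yes p | inj₁ none = inj₂ (zero , p , λ { zero _ → ≤-refl ; (suc j) pj → ⊥-elim (none j pj) })
  ... | yes p | inj₂ (i , pi , min) with total (f zero) (f (suc i))
  ...   | inj₁ f0≤fi = inj₂ (zero , p , λ { zero _ → ≤-refl ; (suc j) pj → ≤-trans f0≤fi (min j pj) })
  ...   | inj₂ fi≤f0 = inj₂ (suc i , pi , λ { zero _ → fi≤f0 ; (suc j) → min j })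

-- Fourier-Motzkin elimination with natural multipliers

module FourierMotzkin {c ℓ₁ ℓ₂} (T : OrderedField c ℓ₁ ℓ₂) where
  open OrderedFieldProperties T
  open import Relation.Binary.Reasoning.Setoid setoid

  -- The multipliers depend on A only: one elimination serves every b.
  record Elimination {N m} (A : Fin N → Vector Carrier m) : Set (c Level.⊔ ℓ₁ Level.⊔ ℓ₂) where
    field
      {M}         : ℕ
      multipliers : Fin M → Vector Carrier N
      isNat       : ∀ j i → IsNat (multipliers j i)
      annihilates : ∀ j k → dot (multipliers j) (λ i → A i k) ≈ 0#
      complete    : ∀ b → (∀ j → 0# ≤ dot (multipliers j) b) →
                    ∃ λ x → ∀ i → dot (A i) x ≤ b i

  module OneVariable {N} (a : Vector Carrier N) (a-isInt : ∀ i → IsInt (a i)) where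

    -- A null row is kept as it is; a positive and a negative row are crossed so that the variable
    -- cancels. All other pairs yield the zero multiplier, whose inequality is trivial, so every
    -- pair of rows can serve as an index.
    multiplierFor : ∀ {i i′} → Sign (a i) → Sign (a i′) → Vector Carrier N
    multiplierFor {i} {i′} (sign₀ _) _ = δ i
    multiplierFor {i} {i′} (sign₊ _ _) (sign₋ _ _) = λ k → - a i′ * δ i k + a i * δ i′ k
    multiplierFor {i} {i′} _              _              = λ _ → 0#

    dot-pair : ∀ i i′ f → dot (λ k → - a i′ * δ i k + a i * δ i′ k) f ≈ - a i′ * f i + a i * f i′
    dot-pair i i′ f = trans (dot-+ˡ _ _ f)
      (+-cong (trans (dot-*ˡ _ _ f) (*-congˡ (dot-δ i f))) (trans (dot-*ˡ _ _ f) (*-congˡ (dot-δ i′ f))))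

    multiplierFor-isNat : ∀ {i i′} (s : Sign (a i)) (s′ : Sign (a i′)) k → IsNat (multiplierFor s s′ k)
    multiplierFor-isNat {i} (sign₀ _) _ k = δ-isNat i k
    multiplierFor-isNat {i} {i′} (sign₊ p _) (sign₋ q _) k = +-isNat (*-isNat q (δ-isNat i k)) (*-isNat p (δ-isNat i′ k))
    multiplierFor-isNat (sign₊ _ _) (sign₀ _) k = 0-isNat
    multiplierFor-isNat (sign₊ _ _) (sign₊ _ _) k = 0-isNat
    multiplierFor-isNat (sign₋ _ _) _ k = 0-isNat

    multiplierFor-annihilates : ∀ {i i′} (s : Sign (a i)) (s′ : Sign (a i′)) → dot (multiplierFor s s′) a ≈ 0#
    multiplierFor-annihilates {i} (sign₀ ai≈0) _ = trans (dot-δ i a) ai≈0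
    multiplierFor-annihilates {i} {i′} (sign₊ _ _) (sign₋ _ _) = begin
      dot (λ k → - a i′ * δ i k + a i * δ i′ k) a ≈⟨ dot-pair i i′ a ⟩
      - a i′ * a i + a i * a i′                   ≈⟨ +-cong (sym (-‿distribˡ-* (a i′) (a i))) (*-comm (a i) (a i′)) ⟩
      - (a i′ * a i) + a i′ * a i                 ≈⟨ -‿inverseˡ _ ⟩
      0#                                          ∎
    multiplierFor-annihilates (sign₊ _ _) (sign₀ _) = dot-zeroˡ a (λ _ → refl)
    multiplierFor-annihilates (sign₊ _ _) (sign₊ _ _) = dot-zeroˡ a (λ _ → refl)
    multiplierFor-annihilates (sign₋ _ _) _ = dot-zeroˡ a (λ _ → refl)

    signAt : ∀ i → Sign (a i)
    signAt i = sign (a-isInt i)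

    module _ (β : Vector Carrier N)
             (valid : ∀ i i′ → 0# ≤ dot (multiplierFor (signAt i) (signAt i′)) β) where

      -- The diagonal pair of a null row has multiplier `δ i`, so validity there is the claim
      -- itself.
      null-valid : ∀ {i} → a i ≈ 0# → 0# ≤ β i
      null-valid {i} ai≈0 with signAt i | valid i i
      ... | sign₀ _ | v = ≤-respʳ-≈ (dot-δ i β) v
      ... | sign₊ _ 0<ai | _ = ⊥-elim (0<⇒≉ 0<ai ai≈0)
      ... | sign₋ _ 0<-ai | _ = ⊥-elim (0<⇒≉ 0<-ai (trans (-‿cong ai≈0) -0#≈0#))

      pair-valid : ∀ {i i′} → 0# < a i → 0# < - a i′ → 0# ≤ - a i′ * β i + a i * β i′
      pair-valid {i} {i′} 0<ai 0<-ai′ with signAt i | signAt i′ | valid i i′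
      ... | sign₀ ai≈0 | _ | _ = ⊥-elim (0<⇒≉ 0<ai ai≈0)
      ... | sign₋ _ 0<-ai | _ | _ = ⊥-elim (0<⇒≯ 0<ai 0<-ai)
      ... | sign₊ _ _ | sign₀ ai′≈0 | _ = ⊥-elim (0<⇒≉ 0<-ai′ (trans (-‿cong ai′≈0) -0#≈0#))
      ... | sign₊ _ _ | sign₊ _ 0<ai′ | _ = ⊥-elim (0<⇒≯ 0<ai′ 0<-ai′)
      ... | sign₊ _ _ | sign₋ _ _ | v = ≤-respʳ-≈ (dot-pair i i′ β) v

      null-solved : ∀ {i} y → a i ≈ 0# → a i * y ≤ β i
      null-solved y ai≈0 = ≤-respˡ-≈ (sym (trans (*-congʳ ai≈0) (zeroˡ y))) (null-valid ai≈0)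

      -- Positive rows bound `y` above and negative rows bound it below. The tightest upper bound is
      -- chosen if there is one, otherwise the tightest lower bound, otherwise 0.
      solvable : ∃ λ y → ∀ i → a i * y ≤ β i
      solvable with argmin (λ i → 0# <? a i) (λ i → a i ⁻¹ * β i)
                  | argmin (λ i → 0# <? - a i) (λ i → (- a i) ⁻¹ * β i)
      ... | inj₂ (i₀ , 0<ai₀ , min) | _ = y , solved
        where
        y = a i₀ ⁻¹ * β i₀

        solved : ∀ i → a i * y ≤ β i
        solved i with sign (a-isInt i)
        ... | sign₀ ai≈0 = null-solved y ai≈0
        ... | sign₊ _ 0<ai = ≤-respʳ-≈ (a[a⁻¹x]≈x (0<⇒≉ 0<ai) (β i)) (*-monoˡ-≤ (proj₁ 0<ai) (min i 0<ai))
        -- Multiplied by the positive `a i₀`, the slack of the negative row becomes the crossed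
        -- inequality of rows `i₀` and `i`.
        ... | sign₋ _ 0<-ai = 0≤y-x⇒x≤y (*-cancelˡ-nonneg 0<ai₀ (≤-respʳ-≈ (begin
          - a i * β i₀ + a i₀ * β i           ≈⟨ +-congʳ (*-congˡ (a[a⁻¹x]≈x (0<⇒≉ 0<ai₀) (β i₀))) ⟨
          - a i * (a i₀ * y) + a i₀ * β i     ≈⟨ solve 4 (λ n p y b → n :* (p :* y) :+ p :* b := p :* (b :+ n :* y)) refl (- a i) (a i₀) y (β i) ⟩
          a i₀ * (β i + - a i * y)            ≈⟨ *-congˡ (+-congˡ (-‿distribˡ-* (a i) y)) ⟨
          a i₀ * (β i - a i * y)              ∎) (pair-valid 0<ai₀ 0<-ai)))
      ... | inj₁ noPositive | inj₂ (i₀ , _ , min) = - z , solved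
        where
        -- Negative rows read `- y ≤ (- a i) ⁻¹ * β i`, so the least right-hand side is the value
        -- for `- y`.
        z = (- a i₀) ⁻¹ * β i₀

        solved : ∀ i → a i * - z ≤ β i
        solved i with sign (a-isInt i)
        ... | sign₀ ai≈0 = null-solved (- z) ai≈0
        ... | sign₊ _ 0<ai = ⊥-elim (noPositive i 0<ai)
        ... | sign₋ _ 0<-ai = ≤-respʳ-≈ (a[a⁻¹x]≈x (0<⇒≉ 0<-ai) (β i))
          (≤-respˡ-≈ (trans (sym (-‿distribˡ-* (a i) z)) (-‿distribʳ-* (a i) z)) (*-monoˡ-≤ (proj₁ 0<-ai) (min i 0<-ai)))
      ... | inj₁ noPositive | inj₁ noNegative = 0# , solved
        where
        solved : ∀ i → a i * 0# ≤ β i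
        solved i with sign (a-isInt i)
        ... | sign₀ ai≈0 = null-solved 0# ai≈0
        ... | sign₊ _ 0<ai = ⊥-elim (noPositive i 0<ai)
        ... | sign₋ _ 0<-ai = ⊥-elim (noNegative i 0<-ai)

    elimination : Elimination (λ i → λ (_ : Fin 1) → a i)
    elimination = record
      { multipliers = multipliers
      ; isNat       = λ j → multiplierFor-isNat (signAt (proj₁ (split j))) (signAt (proj₂ (split j)))
      ; annihilates = λ j _ → multiplierFor-annihilates (signAt (proj₁ (split j))) (signAt (proj₂ (split j)))
      ; complete    = λ b valid → let (y , solved) = solvable b (λ i i′ → ≡.subst (λ (i , i′) → 0# ≤ dot (multiplierFor (signAt i) (signAt i′)) b) (Fin.remQuot-combine i i′) (valid (combine i i′)))
                      in (λ _ → y) , λ i → ≤-respˡ-≈ (sym (+-identityʳ _)) (solved i)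
      }
      where
      split : Fin (N ℕ.* N) → Fin N × Fin N
      split = remQuot {N} N

      multipliers : Fin (N ℕ.* N) → Vector Carrier N
      multipliers j = multiplierFor (signAt (proj₁ (split j))) (signAt (proj₂ (split j)))

  -- The first variable is eliminated, then recursion treats the combined rows. The multipliers of
  -- the two stages compose as matrices, which keeps them natural.
  eliminate : ∀ {N m} (A : Fin N → Vector Carrier m) → (∀ i k → IsInt (A i k)) → Elimination A
  eliminate {m = zero} A A-isInt = record
    { multipliers = δ
    ; isNat       = δ-isNat
    ; annihilates = λ _ ()
    ; complete    = λ b valid → (λ ()) , λ i → ≤-respʳ-≈ (dot-δ i b) (valid i)
    }
  eliminate {N} {suc m} A A-isInt = record
    { multipliers = multipliers
    ; isNat       = λ l i → dot-isNat (Rest.isNat l) (λ j → Head.isNat j i)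
    ; annihilates = annihilates
    ; complete    = complete
    }
    where
    module Head = Elimination (OneVariable.elimination (λ i → A i zero) (λ i → A-isInt i zero))

    A′ : Fin Head.M → Vector Carrier m
    A′ j k = dot (Head.multipliers j) (λ i → A i (suc k))

    module Rest = Elimination (eliminate A′ (λ j k → dot-isInt (Head.isNat j) (λ i → A-isInt i (suc k))))

    multipliers : Fin Rest.M → Vector Carrier N
    multipliers l i = dot (Rest.multipliers l) (λ j → Head.multipliers j i)

    dot-multipliers : ∀ l f → dot (Rest.multipliers l) (λ j → dot (Head.multipliers j) f) ≈ dot (multipliers l) f
    dot-multipliers l f = dot-assoc (Rest.multipliers l) Head.multipliers f

    annihilates : ∀ l k → dot (multipliers l) (λ i → A i k) ≈ 0#
    annihilates l zero    = trans (sym (dot-multipliers l _)) (dot-zeroʳ (Rest.multipliers l) (λ j → Head.annihilates j zero))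
    annihilates l (suc k) = trans (sym (dot-multipliers l _)) (Rest.annihilates l k)

    complete : ∀ b → (∀ l → 0# ≤ dot (multipliers l) b) → ∃ λ x → ∀ i → dot (A i) x ≤ b i
    complete b valid = head zero Vector.∷ x′ , solved
      where
      rest = Rest.complete (λ j → dot (Head.multipliers j) b) (λ l → ≤-respʳ-≈ (sym (dot-multipliers l b)) (valid l))
      x′   = proj₁ rest

      -- Back-substitution: `β` is what remains of the right-hand side for the first variable once
      -- `x′` is fixed.
      β : Vector Carrier N
      β i = b i - dot (A i ∘ suc) x′

      β-valid : ∀ j → 0# ≤ dot (Head.multipliers j) β
      β-valid j = ≤-respʳ-≈ (sym (begin
        dot E β                                                      ≈⟨ dot-+ʳ E b _ ⟩
        dot E b + dot E (λ i → - dot (A i ∘ suc) x′)                 ≈⟨ +-congˡ (dot-negʳ E (λ i → dot (A i ∘ suc) x′)) ⟩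
        dot E b - dot E (λ i → dot (A i ∘ suc) x′)                   ≈⟨ +-congˡ (-‿cong (dot-assoc E (λ i → A i ∘ suc) x′)) ⟩
        dot E b - dot (A′ j) x′                                      ∎))
        (x≤y⇒0≤y-x (proj₂ rest j))
        where E = Head.multipliers j

      head = proj₁ (Head.complete β β-valid)

      solved : ∀ i → dot (A i) (head zero Vector.∷ x′) ≤ b i
      solved i = ≤-respʳ-≈ (begin
        β i + dot (A i ∘ suc) x′                     ≈⟨ +-assoc _ _ _ ⟩
        b i + (- dot (A i ∘ suc) x′ + dot (A i ∘ suc) x′) ≈⟨ +-congˡ (-‿inverseˡ _) ⟩
        b i + 0#                                     ≈⟨ +-identityʳ _ ⟩
        b i                                          ∎)
        (+-mono-≤ (dot (A i ∘ suc) x′) (≤-respˡ-≈ (+-identityʳ _) (proj₂ (Head.complete β β-valid) i)))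

-- Discarding zero coefficients

module Supports {c ℓ₁ ℓ₂} (T : OrderedField c ℓ₁ ℓ₂) where
  open OrderedFieldProperties T

  -- Hyperpaths and hypercycles demand strictly positive coefficients, whereas multipliers may
  -- vanish. The field `null⇒smaller` provides the descent on the number of constraints.
  record Support {N} (a : Vector Carrier N) : Set (c Level.⊔ ℓ₁) where
    field
      {r}                : ℕ
      index              : Fin r → Fin N
      index-injective    : Injective _≡_ _≡_ index
      numerator          : Vector ℕ r
      numerator-positive : ∀ i → 0 ℕ.< numerator i
      dot-support        : ∀ f → dot a f ≈ dot (fromℕ ∘ numerator) (f ∘ index)
      null⇒smaller       : ∀ i → a i ≈ 0# → r ℕ.< N

  support : ∀ {N} {a : Vector Carrier N} → (∀ i → IsNat (a i)) → Support a
  support {zero} a-isNat = record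
    { r = 0 ; index = λ () ; index-injective = λ { {()} } ; numerator = λ () ; numerator-positive = λ ()
    ; dot-support = λ _ → refl ; null⇒smaller = λ () }
  support {suc N} {a} a-isNat with support (a-isNat ∘ suc) | a-isNat zero
  ... | s | zero , a₀≈0 = record
    { index              = suc ∘ index
    ; index-injective    = index-injective ∘ Fin.suc-injective
    ; numerator          = numerator
    ; numerator-positive = numerator-positive
    ; dot-support        = λ f → trans (+-cong (trans (*-congʳ a₀≈0) (zeroˡ _)) (dot-support (f ∘ suc))) (+-identityˡ _)
    ; null⇒smaller       = λ _ _ → s≤s (Fin.injective⇒≤ index-injective)
    }
    where open Support s
  ... | s | suc k , a₀≈1+k = record
    { index              = zero Vector.∷ (suc ∘ index)
    ; index-injective    = λ { {zero} {zero} _ → ≡.refl ; {suc i} {suc j} p → ≡.cong suc (index-injective (Fin.suc-injective p)) }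
    ; numerator          = suc k Vector.∷ numerator
    ; numerator-positive = λ { zero → s≤s z≤n ; (suc i) → numerator-positive i }
    ; dot-support        = λ f → +-cong (*-congʳ a₀≈1+k) (dot-support (f ∘ suc))
    ; null⇒smaller       = λ { zero a₀≈0 → ⊥-elim (0<⇒≉ (fromℕ-positive {suc k} (s≤s z≤n)) (trans (sym a₀≈1+k) a₀≈0))
                             ; (suc i) aᵢ≈0 → s≤s (null⇒smaller i aᵢ≈0) }
    }
    where open Support s

-- Extended weights and normal vectors

module FourCSPProperties {c ℓ₁ ℓ₂} (T : OrderedField c ℓ₁ ℓ₂) (n : ℕ) where
  open OrderedFieldProperties T hiding (fromℕ)
  open FourCSP T n
  open Supports T
  open FourierMotzkin T
  open ExtendedEquality _≈_ using () renaming ([_] to [_]≈)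
  open ExtendedOrder _≤_ using (⊥±≤_; _≤⊤±; ≤±-trans; ≤±-reflexive; [≤]-injective) renaming ([_] to [_]≤)
  open import Relation.Binary.Reasoning.Setoid setoid

  weightedSum-[] : ∀ {r} (a : Vector Carrier r) {w f} → (∀ i → w i ≡ [ f i ]) → weightedSum a w ≡ [ dot a f ]
  weightedSum-[] {zero}  a p = ≡.refl
  weightedSum-[] {suc r} a p rewrite p zero | weightedSum-[] (a ∘ suc) (p ∘ suc) = ≡.refl

  -- Since +∞ absorbs, a right-hand side containing it is the top element. Otherwise no +∞ occurs on
  -- either side, and a -∞ on the left makes the left sum the bottom element.
  +±-mono-≤± : ∀ {x y u v} → x ≤± y → u ≤± v → (x +± u) ≤± (y +± v)
  +±-mono-≤± {x} {⊤±} {u} _ _ = (x +± u) ≤⊤±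
  +±-mono-≤± {x} {⊥±}    {u} {⊤±} _ _ = (x +± u) ≤⊤±
  +±-mono-≤± {x} {[ _ ]} {u} {⊤±} _ _ = (x +± u) ≤⊤±
  +±-mono-≤± {⊥±} {y} {⊥±} {v} _ _ = ⊥±≤ _
  +±-mono-≤± {⊥±} {y} {[ _ ]} {v} _ _ = ⊥±≤ _
  +±-mono-≤± {[ _ ]} {y} {⊥±} {v} _ _ = ⊥±≤ _
  +±-mono-≤± {[ _ ]} {⊥±} {[ _ ]} {[ _ ]} AddSupremum.[ () ] _
  +±-mono-≤± {[ _ ]} {[ _ ]} {[ _ ]} {[ _ ]} [ p ]≤ [ q ]≤ = [ +-mono₂-≤ p q ]≤

  *±-mono-≤± : ∀ {a x y} → 0# ≤ a → x ≤± y → (a *± x) ≤± (a *± y)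
  *±-mono-≤± {a} {x} {⊤±}        _   _      = (a *± x) ≤⊤±
  *±-mono-≤± {x = ⊥±}            _   _      = ⊥±≤ _
  *±-mono-≤± {x = [ _ ]} {[ _ ]} 0≤a [ p ]≤ = [ *-monoˡ-≤ 0≤a p ]≤

  weightedSum-mono-≤± : ∀ {r} {a : Vector Carrier r} {w w′} → (∀ i → 0# ≤ a i) →
                        (∀ i → w i ≤± w′ i) → weightedSum a w ≤± weightedSum a w′
  weightedSum-mono-≤± {zero}  p q = [ ≤-refl ]≤
  weightedSum-mono-≤± {suc r} p q = +±-mono-≤± (*±-mono-≤± (p zero) (q zero)) (weightedSum-mono-≤± (p ∘ suc) (q ∘ suc))

  e≈δ : ∀ k l → e (suc k) l ≡ δ k l
  e≈δ k l with k Fin.≟ l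
  ... | yes ≡.refl = ≡.sym (δ-diagonal k)
  ... | no  k≢l    = ≡.sym (δ-offDiagonal k≢l)

  e-isInt : ∀ i k → IsInt (e i k)
  e-isInt zero    k = IsNat⇒IsInt 0-isNat
  e-isInt (suc i) k rewrite e≈δ i k = IsNat⇒IsInt (δ-isNat i k)

  normalVector-isInt : ∀ s k → IsInt (normalVector s k)
  normalVector-isInt (i , j , p , q) k =
    +-isInt (+-isInt (+-isInt (e-isInt i k) (neg-isInt (e-isInt j k))) (neg-isInt (e-isInt p k))) (e-isInt q k)

  dot-e : ∀ i ν → dot (e i) ν ≈ value ν i
  dot-e zero    ν = dot-zeroˡ ν (λ _ → refl)
  dot-e (suc i) ν = trans (dot-congˡ ν (λ k → reflexive (e≈δ i k))) (dot-δ i ν)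

  dot-normalVector : ∀ i j p q ν → dot (normalVector (i , j , p , q)) ν ≈
                     (value ν i - value ν j) - (value ν p - value ν q)
  dot-normalVector i j p q ν = begin
    dot (normalVector (i , j , p , q)) ν                      ≈⟨ dot-+ˡ _ (e q) ν ⟩
    dot (λ k → e i k - e j k - e p k) ν + dot (e q) ν         ≈⟨ +-cong (trans (dot-+ˡ _ _ ν) (+-cong (trans (dot-+ˡ (e i) _ ν) (+-cong (dot-e i ν) (neg j))) (neg p))) (dot-e q ν) ⟩
    value ν i - value ν j - value ν p + value ν q             ≈⟨ +-assoc _ _ _ ⟩
    value ν i - value ν j + (- value ν p + value ν q)         ≈⟨ +-congˡ (+-congˡ (-‿involutive _)) ⟨
    value ν i - value ν j + (- value ν p + - (- value ν q))   ≈⟨ +-congˡ (-‿+-comm _ _) ⟩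
    (value ν i - value ν j) - (value ν p - value ν q)         ∎
    where
    neg : ∀ i → dot (λ k → - e i k) ν ≈ - value ν i
    neg i = trans (dot-negˡ (e i) ν) (-‿cong (dot-e i ν))

  satisfies⇒dot≤ : ∀ {ν} c → Satisfies ν c → dot (F-v c) ν ≤ bound c
  satisfies⇒dot≤ {ν} ((i , j , p , q) , _) = ≤-respˡ-≈ (sym (dot-normalVector i j p q ν))

  dot≤⇒satisfies : ∀ {ν} c → dot (F-v c) ν ≤ bound c → Satisfies ν c
  dot≤⇒satisfies {ν} ((i , j , p , q) , _) = ≤-respˡ-≈ (dot-normalVector i j p q ν)

  complement-cancels : ∀ s k → normalVector (complement s) k + normalVector s k ≈ 0#
  complement-cancels (i , j , p , q) k = begin
    (e j k - e i k - e q k + e p k) + (e i k - e j k - e p k + e q k)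
      ≈⟨ solve 8 (λ i j p q i′ j′ p′ q′ → (j :+ i′ :+ q′ :+ p) :+ (i :+ j′ :+ p′ :+ q) := (i :+ i′) :+ ((j :+ j′) :+ ((p :+ p′) :+ (q :+ q′))))
           refl (e i k) (e j k) (e p k) (e q k) (- e i k) (- e j k) (- e p k) (- e q k) ⟩
    (e i k - e i k) + ((e j k - e j k) + ((e p k - e p k) + (e q k - e q k)))
      ≈⟨ cancel (e i k) (trans (cancel (e j k) (trans (cancel (e p k) (-‿inverseʳ _)) refl)) refl) ⟩
    0# ∎
    where
    cancel : ∀ x {y} → y ≈ 0# → (x - x) + y ≈ 0#
    cancel x y≈0 = trans (+-cong (-‿inverseʳ x) y≈0) (+-identityˡ 0#)

  dot-complement : ∀ s ν → dot (normalVector s) ν ≈ - dot (normalVector (complement s)) ν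
  dot-complement s ν = begin
    dot (normalVector s) ν                    ≈⟨ x+[-x+y]≈y W _ ⟨
    W + (- W + dot (normalVector s) ν)        ≈⟨ solve 3 (λ w w′ v → w :+ (w′ :+ v) := w′ :+ (w :+ v)) refl W (- W) _ ⟩
    - W + (W + dot (normalVector s) ν)        ≈⟨ +-congˡ (dot-+ˡ _ _ ν) ⟨
    - W + dot (λ k → normalVector (complement s) k + normalVector s k) ν ≈⟨ +-congˡ (dot-zeroˡ ν (complement-cancels s)) ⟩
    - W + 0#                                  ≈⟨ +-identityʳ _ ⟩
    - W                                       ∎
    where W = dot (normalVector (complement s)) ν

  distinctNonzero-reindex : ∀ {r s} {V : Vector (Vector Carrier n) r} {ι : Fin s → Fin r} →
                            Injective _≡_ _≡_ ι → DistinctNonzero V → DistinctNonzero (V ∘ ι)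
  distinctNonzero-reindex {ι = ι} ι-injective (distinct , nonzero) = (λ i≢j → distinct (i≢j ∘ ι-injective)) , nonzero ∘ ι

  dot-balanced : ∀ {r} (a : Vector Carrier r) (V : Vector (Vector Carrier n) r) ν →
                 (∀ k → linearCombination a V k ≈ 0#) → dot a (λ i → dot (V i) ν) ≈ 0#
  dot-balanced a V ν balanced = trans (dot-assoc a V ν) (dot-zeroˡ ν balanced)

  -- One tightest constraint per nonzero normal vector

  infix 4 _≋_
  _≋_ : Vector Carrier n → Vector Carrier n → Set ℓ₁
  u ≋ v = ∀ k → u k ≈ v k

  _≋?_ : ∀ u v → Dec (u ≋ v)
  u ≋? v = Fin.all? (λ k → u k ≟ v k)

  -- Hyperpaths and hypercycles need distinct nonzero normal vectors, so only a
  -- tightest constraint of S for each nonzero normal vector is kept.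
  record Reduction (S : 4-CSP) : Set (c Level.⊔ ℓ₁ Level.⊔ ℓ₂) where
    field
      {N}      : ℕ
      tightest : Vector Constraint N
      member   : ∀ i → tightest i ∈ᶜ S
      distinct : DistinctNonzero (F-v ∘ tightest)
      covers   : ∀ {c} → c ∈ᶜ S → F-v c ≋ 𝟎 ⊎
                 (∃ λ i → F-v c ≋ F-v (tightest i) × bound (tightest i) ≤ bound c)

  reduce : ∀ S → Reduction S
  reduce [] = record { N = 0 ; tightest = λ () ; member = λ () ; distinct = (λ { {()} }) , λ () ; covers = λ () }
  reduce (c ∷ S) with reduce S | F-v c ≋? 𝟎
  ... | R | yes c-null = record
    { tightest = tightest
    ; member   = there ∘ member
    ; distinct = distinct
    ; covers   = λ { (here (≡.refl , _)) → inj₁ c-null ; (there d∈S) → covers d∈S }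
    }
    where open Reduction R
  ... | R | no c-nonnull with Fin.any? (λ i → F-v c ≋? F-v (Reduction.tightest R i))
  ...   | no new = record
    { tightest = c Vector.∷ tightest
    ; member   = λ { zero → here (≡.refl , refl) ; (suc i) → there (member i) }
    ; distinct = (λ { {zero}  {zero}  i≢j → ⊥-elim (i≢j ≡.refl)
                    ; {zero}  {suc j} _ p → new (j , p)
                    ; {suc i} {zero}  _ p → new (i , sym ∘ p)
                    ; {suc i} {suc j} i≢j → proj₁ distinct (i≢j ∘ ≡.cong suc) })
               , λ { zero → c-nonnull ; (suc i) → proj₂ distinct i }
    ; covers   = λ { (here (≡.refl , m≈)) → inj₂ (zero , (λ _ → refl) , ≤-reflexive (sym m≈))
                   ; (there d∈S) → Sum.map₂ (λ (i , p) → suc i , p) (covers d∈S) }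
    }
    where open Reduction R
  ...   | yes (i , c∥i) with bound c ≤? bound (Reduction.tightest R i)
  ...     | no c≰i = record
    { tightest = tightest
    ; member   = there ∘ member
    ; distinct = distinct
    ; covers   = λ { (here (≡.refl , m≈)) → inj₂ (i , c∥i , ≤-respʳ-≈ (sym m≈) (≰⇒≥ c≰i)) ; (there d∈S) → covers d∈S }
    }
    where open Reduction R
  -- The new constraint is tighter, so it takes the place of its parallel predecessor; the normal
  -- vectors, and with them distinctness, stay the same up to `_≋_`.
  ...     | yes c≤i = record
    { tightest = tightest′
    ; member   = member′
    ; distinct = (λ i≢j p → proj₁ distinct i≢j (λ k → trans (sym (parallel _ k)) (trans (p k) (parallel _ k))))
               , λ j p → proj₂ distinct j (λ k → trans (sym (parallel j k)) (p k))
    ; covers   = λ { (here (≡.refl , m≈)) → inj₂ (i , (λ k → trans (c∥i k) (sym (parallel i k))) , ≤-respʳ-≈ (sym m≈) tight)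
                   ; (there d∈S) → Sum.map₂ (λ (j , p , q) → j , (λ k → trans (p k) (sym (parallel j k))) , ≤-trans (tighter j) q) (covers d∈S) }
    }
    where
    open Reduction R
    tightest′ : Vector Constraint N
    tightest′ j with i Fin.≟ j
    ... | yes _ = c
    ... | no  _ = tightest j

    member′ : ∀ j → tightest′ j ∈ᶜ (c ∷ S)
    member′ j with i Fin.≟ j
    ... | yes _ = here (≡.refl , refl)
    ... | no  _ = there (member j)

    parallel : ∀ j → F-v (tightest′ j) ≋ F-v (tightest j)
    parallel j with i Fin.≟ j
    ... | yes ≡.refl = c∥i
    ... | no  _      = λ _ → refl

    tighter : ∀ j → bound (tightest′ j) ≤ bound (tightest j)
    tighter j with i Fin.≟ j
    ... | yes ≡.refl = c≤i
    ... | no  _      = ≤-refl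

    tight : bound (tightest′ i) ≤ bound c
    tight with i Fin.≟ i
    ... | yes _   = ≤-refl
    ... | no  i≢i = ⊥-elim (i≢i ≡.refl)

  -- Bounds on hyperpath weights

  module _ (S : 4-CSP) where

    F-b-member : ∀ {d} → d ∈ᶜ S → F-b S d ≡ [ bound d ]
    F-b-member {d} d∈S with d ∈ᶜ? S
    ... | yes _  = ≡.refl
    ... | no d∉S = ⊥-elim (d∉S d∈S)

    F-b-bounds : ∀ {ν} → D S ν → ∀ d → [ dot (F-v d) ν ] ≤± F-b S d
    F-b-bounds ν∈D d with d ∈ᶜ? S
    ... | yes d∈S = [ satisfies⇒dot≤ d (ν∈D d∈S) ]≤
    ... | no  _   = _ ≤⊤±

    coefficient-nonneg : ∀ {d} (p : HyperPath d) i → 0# ≤ HyperPath.coefficient p i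
    coefficient-nonneg p i = *-nonneg (fromℕ-nonneg (numerator i)) (⁻¹-nonneg (fromℕ-positive denominator-positive))
      where open HyperPath p

    -- This is weak duality: the inequalities that `ν` satisfies are added up along the path, and
    -- balance turns the left-hand sides into `F-v d` applied to `ν`. Constraints outside `S` weigh
    -- +∞ and do no harm.
    pathWeight-bounds : ∀ {ν} → D S ν → ∀ {d} (p : HyperPath d) → [ dot (F-v d) ν ] ≤± pathWeight S p
    pathWeight-bounds {ν} ν∈D {d} p = ≤±-trans ≤-trans
      (≤±-reflexive ≤-reflexive [ trans (dot-complement (shape d) ν) (sym along-path) ]≈)
      (≡.subst (_≤± pathWeight S p) (weightedSum-[] coefficient (λ _ → ≡.refl))
        (weightedSum-mono-≤± (coefficient-nonneg p) (F-b-bounds ν∈D ∘ path)))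
      where
      open HyperPath p
      W = normalVector (complement (shape d))
      L = linearCombination coefficient (F-v ∘ path)

      along-path : dot coefficient (λ i → dot (F-v (path i)) ν) ≈ - dot W ν
      along-path = begin
        dot coefficient (λ i → dot (F-v (path i)) ν) ≈⟨ dot-assoc coefficient (F-v ∘ path) ν ⟩
        dot L ν                                      ≈⟨ x+[-x+y]≈y (dot W ν) _ ⟨
        dot W ν + (- dot W ν + dot L ν)              ≈⟨ solve 3 (λ w w′ v → w :+ (w′ :+ v) := w′ :+ (w :+ v)) refl (dot W ν) (- dot W ν) _ ⟩
        - dot W ν + (dot W ν + dot L ν)              ≈⟨ +-congˡ (dot-+ˡ W L ν) ⟨
        - dot W ν + dot (W ⊕ L) ν                    ≈⟨ +-congˡ (dot-zeroˡ ν balanced) ⟩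
        - dot W ν + 0#                               ≈⟨ +-identityʳ _ ⟩
        - dot W ν                                    ∎

    1-coefficient : fromℕ 1 * fromℕ 1 ⁻¹ ≈ 1#
    1-coefficient = ⁻¹-inverse (0<⇒≉ (fromℕ-positive {1} (s≤s z≤n)))

    -- The path is `d` itself with coefficient 1/1, balanced because `d` cancels its complement. It
    -- shows that a minimum weight never exceeds the bound.
    trivialPath : ∀ d → ¬ (F-v d ≋ 𝟎) → HyperPath d
    trivialPath d nonnull = record
      { r                    = 1
      ; r>0                  = s≤s z≤n
      ; path                 = λ _ → d
      ; distinct             = (λ { {zero} {zero} i≢j → ⊥-elim (i≢j ≡.refl) }) , λ _ → nonnull
      ; denominator          = 1
      ; numerator            = λ _ → 1
      ; denominator-positive = s≤s z≤n
      ; numerator-positive   = λ _ → s≤s z≤n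
      ; balanced             = λ k → trans (+-congˡ (trans (+-identityʳ _) (trans (*-congʳ 1-coefficient) (*-identityˡ _))))
                                       (complement-cancels (shape d) k)
      }

    trivialPath-weight : ∀ {d} nonnull → d ∈ᶜ S → pathWeight S (trivialPath d nonnull) ≈± [ bound d ]
    trivialPath-weight {d} nonnull d∈S
      rewrite F-b-member d∈S = [ trans (+-identityʳ _) (trans (*-congʳ 1-coefficient) (*-identityˡ _)) ]≈

    minWeight≤bound : ∀ {d w} → ¬ (F-v d ≋ 𝟎) → d ∈ᶜ S → MinWeight S d w → w ≤± [ bound d ]
    minWeight≤bound nonnull d∈S (inside _ (attained _ least)) = least (trivialPath _ nonnull , trivialPath-weight nonnull d∈S)
    minWeight≤bound nonnull d∈S (inside _ (unbounded _))      = ⊥±≤ _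
    minWeight≤bound nonnull d∈S (outside d∉S)                 = ⊥-elim (d∉S d∈S)

  -- Existence of minimum weights

  module _ {S : 4-CSP} (R : Reduction S) where
    open Reduction R

    -- A constraint with zero normal vector has no representative in the reduction; it holds by
    -- `degenerate`. Every other one is implied by its tightest parallel.
    reduced-solution : DegenerateConstraintsHold S → ∀ {ν} →
                       (∀ i → dot (F-v (tightest i)) ν ≤ bound (tightest i)) → D S ν
    reduced-solution degenerate {ν} solved {d} d∈S with covers d∈S
    ... | inj₁ d-null = dot≤⇒satisfies d (≤-respˡ-≈ (sym (dot-zeroˡ ν d-null)) (degenerate d∈S d-null))
    ... | inj₂ (i , parallel , tighter) = dot≤⇒satisfies d
          (≤-respˡ-≈ (sym (dot-congˡ ν parallel)) (≤-trans (solved i) tighter))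

    -- With right-hand side − t in the extra row, a solution ν has F-v d · ν ≥ t.
    rowsFor : Constraint → Fin (suc N) → Vector Carrier n
    rowsFor d = normalVector (complement (shape d)) Vector.∷ (F-v ∘ tightest)

    rowsFor-isInt : ∀ d i k → IsInt (rowsFor d i k)
    rowsFor-isInt d zero    = normalVector-isInt (complement (shape d))
    rowsFor-isInt d (suc i) = normalVector-isInt (shape (tightest i))

    module LeastPath (degenerate : DegenerateConstraintsHold S) {ν₀} (ν₀∈D : D S ν₀)
                     {d : Constraint} (d∈S : d ∈ᶜ S) (nonnull : ¬ (F-v d ≋ 𝟎)) (E : Elimination (rowsFor d)) where
      open Elimination E

      W : Vector Carrier n
      W = normalVector (complement (shape d))

      V : Vector (Vector Carrier n) N
      V = F-v ∘ tightest

      b : Vector Carrier N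
      b = bound ∘ tightest

      μ : Vector Carrier M
      μ j = multipliers j zero

      γ : Fin M → Vector Carrier N
      γ j i = multipliers j (suc i)

      -- With `μ j` zero, the row `γ j` is a dependence among the constraints of the reduction
      -- alone. Its left-hand sides cancel at the known solution `ν₀`, so its bounds sum to at least
      -- 0.
      γ·b-nonneg : ∀ {j} → μ j ≈ 0# → 0# ≤ dot (γ j) b
      γ·b-nonneg {j} μ≈0 = ≤-respˡ-≈
        (dot-balanced (γ j) V ν₀ (λ k → trans (sym (trans (+-congʳ (trans (*-congʳ μ≈0) (zeroˡ _))) (+-identityˡ _))) (annihilates j k)))
        (dot-monoʳ-≤ (λ i → IsNat⇒nonneg (isNat j (suc i))) (λ i → satisfies⇒dot≤ (tightest i) (ν₀∈D (member i))))

      -- The condition of multiplier `j` is `μ j * t ≤ dot (γ j) b`. For positive `μ j` this is the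
      -- assumed quotient bound, and for `μ j` zero it is `γ·b-nonneg`, so elimination yields a
      -- solution.
      reachable : ∀ t → (∀ j → 0# < μ j → t ≤ μ j ⁻¹ * dot (γ j) b) →
                  ∃ λ ν → D S ν × t ≤ dot (F-v d) ν
      reachable t admissible = ν , reduced-solution degenerate (λ i → proj₂ solution (suc i)) ,
        ≤-respˡ-≈ (-‿involutive t) (≤-respʳ-≈ (sym (dot-complement (shape d) ν)) (neg-antimono-≤ (proj₂ solution zero)))
        where
        valid : ∀ j → 0# ≤ μ j * - t + dot (γ j) b
        valid j with 0# <? μ j
        ... | yes 0<μ = ≤-respʳ-≈ (trans (+-congˡ (-‿distribʳ-* (μ j) t)) (+-comm _ _))
              (x≤y⇒0≤y-x (≤-respʳ-≈ (a[a⁻¹x]≈x (0<⇒≉ 0<μ) _) (*-monoˡ-≤ (proj₁ 0<μ) (admissible j 0<μ))))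
        ... | no  0≮μ with μ j ≟ 0#
        ...   | yes μ≈0 = +-nonneg (≤-reflexive (sym (trans (*-congʳ μ≈0) (zeroˡ _)))) (γ·b-nonneg μ≈0)
        ...   | no  μ≉0 = ⊥-elim (0≮μ (IsNat⇒nonneg (isNat j zero) , μ≉0 ∘ sym))

        solution = complete ((- t) Vector.∷ b) valid
        ν = proj₁ solution

      -- Divided by `μ j`, the annihilation of the rows by multiplier `j` is exactly the balance
      -- equation of a hyperpath. Every upper bound on the reachable `t` is thus the weight of a
      -- path.
      combinedPath : ∀ j → 0# < μ j → ∃ λ (p : HyperPath d) → pathWeight S p ≈± [ μ j ⁻¹ * dot (γ j) b ]
      -- The natural number representing `μ j` becomes the common denominator, and the support of
      -- `γ j` supplies the numerators.
      combinedPath j 0<μ with isNat j zero | support (λ i → isNat j (suc i))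
      ... | zero      , μ≈0 | _ = ⊥-elim (0<⇒≉ 0<μ μ≈0)
      ... | q@(suc _) , μ≈q | s = record
        { r>0                  = r>0
        ; path                 = tightest ∘ index
        ; distinct             = distinctNonzero-reindex index-injective distinct
        ; denominator          = q
        ; numerator            = numerator
        ; denominator-positive = s≤s z≤n
        ; numerator-positive   = numerator-positive
        ; balanced             = balanced
        } , ≡.subst (_≈± [ μ j ⁻¹ * dot (γ j) b ])
              (≡.sym (weightedSum-[] (λ i → fromℕ (numerator i) * fromℕ q ⁻¹) (λ i → F-b-member S (member (index i)))))
              [ dot-coefficient b ]≈
        where
        open Support s

        μ≉0 = 0<⇒≉ 0<μ

        dot-coefficient : ∀ f → dot (λ i → fromℕ (numerator i) * fromℕ q ⁻¹) (f ∘ index) ≈ μ j ⁻¹ * dot (γ j) f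
        dot-coefficient f = begin
          dot (λ i → fromℕ (numerator i) * fromℕ q ⁻¹) (f ∘ index) ≈⟨ dot-congˡ (f ∘ index) (λ i → *-comm (fromℕ (numerator i)) (fromℕ q ⁻¹)) ⟩
          dot (λ i → fromℕ q ⁻¹ * fromℕ (numerator i)) (f ∘ index) ≈⟨ dot-*ˡ (fromℕ q ⁻¹) (fromℕ ∘ numerator) (f ∘ index) ⟩
          fromℕ q ⁻¹ * dot (fromℕ ∘ numerator) (f ∘ index)         ≈⟨ *-cong (⁻¹-cong μ≉0 μ≈q) (dot-support f) ⟨
          μ j ⁻¹ * dot (γ j) f                                     ∎

        r>0 : 0 ℕ.< r
        r>0 with 0 ℕ.<? r
        ... | yes 0<r = 0<r
        -- An empty path would force the complement's normal vector to vanish, and then that of `d`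
        -- too.
        ... | no  0≮r = ⊥-elim (nonnull λ k → trans (sym (+-identityˡ _)) (trans (+-congʳ (sym (W≈0 k))) (complement-cancels (shape d) k)))
          where
          γV≈0 : ∀ k → dot (γ j) (λ i → V i k) ≈ 0#
          γV≈0 k = trans (dot-support (λ i → V i k)) (dot-empty (ℕ.n≤0⇒n≡0 (ℕ.≮⇒≥ 0≮r)) _ _)

          W≈0 : ∀ k → W k ≈ 0#
          W≈0 k = begin
            W k                                                  ≈⟨ a⁻¹[ax]≈x μ≉0 (W k) ⟨
            μ j ⁻¹ * (μ j * W k)                                 ≈⟨ *-congˡ (+-identityʳ _) ⟨
            μ j ⁻¹ * (μ j * W k + 0#)                            ≈⟨ *-congˡ (+-congˡ (γV≈0 k)) ⟨
            μ j ⁻¹ * (μ j * W k + dot (γ j) (λ i → V i k))       ≈⟨ *-congˡ (annihilates j k) ⟩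
            μ j ⁻¹ * 0#                                          ≈⟨ zeroʳ _ ⟩
            0#                                                   ∎

        balanced : ∀ k → W k + linearCombination (λ i → fromℕ (numerator i) * fromℕ q ⁻¹) (V ∘ index) k ≈ 0#
        balanced k = begin
          W k + linearCombination (λ i → fromℕ (numerator i) * fromℕ q ⁻¹) (V ∘ index) k ≈⟨ +-cong (a⁻¹[ax]≈x μ≉0 (W k)) (sym (dot-coefficient (λ i → V i k))) ⟨
          μ j ⁻¹ * (μ j * W k) + μ j ⁻¹ * dot (γ j) (λ i → V i k) ≈⟨ distribˡ _ _ _ ⟨
          μ j ⁻¹ * (μ j * W k + dot (γ j) (λ i → V i k))          ≈⟨ *-congˡ (annihilates j k) ⟩
          μ j ⁻¹ * 0#                                            ≈⟨ zeroʳ _ ⟩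
          0#                                                     ∎

      minimum : ∃ λ v → F-bm S d v × (∀ {ν} → D S ν → [ dot (F-v d) ν ] ≤± v)
      minimum with argmin (λ j → 0# <? μ j) (λ j → μ j ⁻¹ * dot (γ j) b)
      ... | inj₂ (j , 0<μ , least) with reachable (μ j ⁻¹ * dot (γ j) b) least | combinedPath j 0<μ
      -- The least quotient is both the weight of the path `p` and at most `F-v d` applied to `ν`.
      -- By weak duality at this `ν`, no path weighs less.
      ...   | ν , ν∈D , t≤ | p , weight = [ μ j ⁻¹ * dot (γ j) b ] ,
        attained (p , weight) (λ (p′ , weight′) → ≤±-trans ≤-trans [ t≤ ]≤ (≤±-trans ≤-trans (pathWeight-bounds S ν∈D p′) (≤±-reflexive ≤-reflexive weight′))) ,
        λ ν∈D → ≤±-trans ≤-trans (pathWeight-bounds S ν∈D p) (≤±-reflexive ≤-reflexive weight)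
      -- Without a positive `μ j` every `t` is reachable, in particular one exceeding the bound that
      -- `d` imposes.
      minimum | inj₁ none with reachable (bound d + 1#) (λ j 0<μ → ⊥-elim (none j 0<μ))
      ... | ν , ν∈D , d+1≤ = ⊥-elim (1≰0 (+-cancelˡ-≤ (bound d)
              (≤-trans d+1≤ (≤-respʳ-≈ (sym (+-identityʳ _)) (satisfies⇒dot≤ d (ν∈D d∈S))))))

  -- Reducing negative dependences to simple hypercycles

  module NegativeCycles (S : 4-CSP) (positive-cycles : ∀ C → IsSimple C → IsPositive S C) where

    -- Subtracting the multiple of β at which some α (ι j) / β j is smallest
    -- keeps α nonnegative, balanced and of negative weight, but shrinks its support.
    module Subtraction {r s} {V : Vector (Vector Carrier n) r} {b : Vector Carrier r} {α : Vector ℕ r}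
      (α-balanced : linearCombination (fromℕ ∘ α) V ≋ 𝟎) (α-negative : ¬ (0# ≤ dot (fromℕ ∘ α) b))
      {ι : Fin s → Fin r} (ι-injective : Injective _≡_ _≡_ ι)
      {β : Vector ℕ s} (β-positive : AllPositive β)
      (β-balanced : linearCombination (fromℕ ∘ β) (V ∘ ι) ≋ 𝟎) (β-nonneg : 0# ≤ dot (fromℕ ∘ β) (b ∘ ι))
      {j₀ : Fin s} (least : ∀ j → fromℕ (β j₀) ⁻¹ * fromℕ (α (ι j₀)) ≤ fromℕ (β j) ⁻¹ * fromℕ (α (ι j)))
      where

      p q : Carrier
      p = fromℕ (β j₀)
      q = fromℕ (α (ι j₀))

      -- This is `β` extended by zero along `ι`, so that it can be subtracted from a vector indexed
      -- like `α`.
      pushforward : Vector Carrier r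
      pushforward i = dot (fromℕ ∘ β) (λ j → δ (ι j) i)

      dot-pushforward : ∀ f → dot pushforward f ≈ dot (fromℕ ∘ β) (f ∘ ι)
      dot-pushforward f = trans (sym (dot-assoc (fromℕ ∘ β) (δ ∘ ι) f))
        (sum-cong-≋ (λ j → *-congˡ (dot-δ (ι j) f)))

      δ-ι : ∀ j j′ → δ (ι j′) (ι j) ≡ δ j j′
      δ-ι j j′ with j Fin.≟ j′
      ... | yes ≡.refl = ≡.trans (δ-diagonal (ι j)) (≡.sym (δ-diagonal j))
      ... | no  j≢j′   = ≡.trans (δ-offDiagonal (λ eq → j≢j′ (≡.sym (ι-injective eq)))) (≡.sym (δ-offDiagonal j≢j′))

      pushforward-ι : ∀ j → pushforward (ι j) ≈ fromℕ (β j)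
      pushforward-ι j = trans (dot-comm (fromℕ ∘ β) (λ j′ → δ (ι j′) (ι j))) (trans (dot-congˡ (fromℕ ∘ β) (λ j′ → reflexive (δ-ι j j′))) (dot-δ j (fromℕ ∘ β)))

      pushforward-outside : ∀ {i} → (∀ j → ι j ≢ i) → pushforward i ≈ 0#
      pushforward-outside ι≢i = dot-zeroʳ (fromℕ ∘ β) (λ j → reflexive (δ-offDiagonal (ι≢i j)))

      -- The subtracted multiple of the extended `β` is `q` over `p`; scaling everything by `p`
      -- clears the denominator and keeps the entries integers.
      γ : Vector Carrier r
      γ i = p * fromℕ (α i) + - (q * pushforward i)

      γ-isInt : ∀ i → IsInt (γ i)
      γ-isInt i = +-isInt (IsNat⇒IsInt (*-isNat (β j₀ , refl) (α i , refl)))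
        (neg-isInt (IsNat⇒IsInt (*-isNat (α (ι j₀) , refl) (dot-isNat (λ j → β j , refl) (λ j → δ-isNat (ι j) i)))))

      γ-nonneg : ∀ i → 0# ≤ γ i
      γ-nonneg i with Fin.any? (λ j → ι j Fin.≟ i)
      ... | no i∉ι = ≤-respʳ-≈ (sym (trans (+-congˡ (trans (-‿cong (trans (*-congˡ (pushforward-outside λ j eq → i∉ι (j , eq))) (zeroʳ q))) -0#≈0#)) (+-identityʳ _)))
                       (*-nonneg (fromℕ-nonneg (β j₀)) (fromℕ-nonneg (α i)))
      -- Minimality of the ratio at `j₀`, multiplied by `fromℕ (β j)` and by `p`, says that the
      -- subtracted term does not exceed the other one.
      ... | yes (j , ≡.refl) = x≤y⇒0≤y-x (≤-respˡ-≈ cross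
                (*-monoˡ-≤ (fromℕ-nonneg (β j₀)) (≤-respʳ-≈ (a[a⁻¹x]≈x (β≉0 j) _) (*-monoˡ-≤ (fromℕ-nonneg (β j)) (least j)))))
        where
        β≉0 : ∀ j → fromℕ (β j) ≉ 0#
        β≉0 j = 0<⇒≉ (fromℕ-positive (β-positive j))

        cross : p * (fromℕ (β j) * (p ⁻¹ * q)) ≈ q * pushforward (ι j)
        cross = begin
          p * (fromℕ (β j) * (p ⁻¹ * q)) ≈⟨ solve 4 (λ p b p′ q → p :* (b :* (p′ :* q)) := p :* (p′ :* q) :* b) refl p (fromℕ (β j)) (p ⁻¹) q ⟩
          p * (p ⁻¹ * q) * fromℕ (β j)   ≈⟨ *-cong (a[a⁻¹x]≈x (β≉0 j₀) q) (sym (pushforward-ι j)) ⟩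
          q * pushforward (ι j)          ∎

      γ-isNat : ∀ i → IsNat (γ i)
      γ-isNat i = IsInt∧nonneg⇒IsNat (γ-isInt i) (γ-nonneg i)

      γ-null : γ (ι j₀) ≈ 0#
      γ-null = trans (+-congˡ (-‿cong (trans (*-congˡ (pushforward-ι j₀)) (*-comm q p)))) (-‿inverseʳ _)

      dot-γ : ∀ f → dot γ f ≈ p * dot (fromℕ ∘ α) f - q * dot (fromℕ ∘ β) (f ∘ ι)
      dot-γ f = trans (dot-+ˡ _ _ f) (+-cong (dot-*ˡ p (fromℕ ∘ α) f)
        (trans (dot-negˡ _ f) (-‿cong (trans (dot-*ˡ q pushforward f) (*-congˡ (dot-pushforward f))))))

      γ-balanced : linearCombination γ V ≋ 𝟎
      γ-balanced k = begin
        dot γ (λ i → V i k)  ≈⟨ dot-γ (λ i → V i k) ⟩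
        p * dot (fromℕ ∘ α) (λ i → V i k) - q * dot (fromℕ ∘ β) (λ j → V (ι j) k) ≈⟨ +-cong (*-congˡ (α-balanced k)) (-‿cong (*-congˡ (β-balanced k))) ⟩
        p * 0# - q * 0#      ≈⟨ +-cong (zeroʳ p) (trans (-‿cong (zeroʳ q)) -0#≈0#) ⟩
        0# + 0#              ≈⟨ +-identityˡ 0# ⟩
        0#                   ∎

      -- A nonnegative weight of `γ` would put `p` times the weight of `α` above `q` times that of
      -- `β`, which is nonnegative; cancelling `p` contradicts `α-negative`.
      γ-negative : ¬ (0# ≤ dot γ b)
      γ-negative 0≤γb = α-negative (*-cancelˡ-nonneg (fromℕ-positive (β-positive j₀))
        (≤-trans (*-nonneg (fromℕ-nonneg (α (ι j₀))) β-nonneg) (0≤y-x⇒x≤y (≤-respʳ-≈ (dot-γ b) 0≤γb))))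

    subtract : ∀ {r s} {V : Vector (Vector Carrier n) r} {b : Vector Carrier r} {α : Vector ℕ r} →
      linearCombination (fromℕ ∘ α) V ≋ 𝟎 → ¬ (0# ≤ dot (fromℕ ∘ α) b) →
      {ι : Fin s → Fin r} → Injective _≡_ _≡_ ι → 0 ℕ.< s → {β : Vector ℕ s} → AllPositive β →
      linearCombination (fromℕ ∘ β) (V ∘ ι) ≋ 𝟎 → 0# ≤ dot (fromℕ ∘ β) (b ∘ ι) →
      ∃ λ (γ : Vector Carrier r) → (∀ i → IsNat (γ i)) × (∃ λ i → γ i ≈ 0#) ×
        linearCombination γ V ≋ 𝟎 × ¬ (0# ≤ dot γ b)
    subtract {s = suc _} {α = α} α-balanced α-negative {ι} ι-injective _ {β} β-positive β-balanced β-nonneg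
      -- The predicate is constantly true, so the minimum is over all of the nonempty `Fin s`.
      with argmin (λ _ → yes tt) (λ j → fromℕ (β j) ⁻¹ * fromℕ (α (ι j)))
    ... | inj₁ none             = ⊥-elim (none zero tt)
    ... | inj₂ (j₀ , _ , least) = γ , γ-isNat , (ι j₀ , γ-null) , γ-balanced , γ-negative
      where open Subtraction {α = α} α-balanced α-negative ι-injective {β} β-positive β-balanced β-nonneg (λ j → least j tt)

    -- The double negation lets each step assume a negative cycle and refute it; decidability of the
    -- order removes it in `nonnegCycles`.
    NonnegCyclesBelow : ℕ → Set _
    NonnegCyclesBelow m =
      ∀ {r} → r ℕ.< m → (cs : Vector Constraint r) → (∀ i → cs i ∈ᶜ S) → DistinctNonzero (F-v ∘ cs) →
      (α : Vector ℕ r) → AllPositive α → linearCombination (fromℕ ∘ α) (F-v ∘ cs) ≋ 𝟎 →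
      ¬ ¬ (0# ≤ dot (fromℕ ∘ α) (bound ∘ cs))

    restrict : ∀ {m N} {a : Vector Carrier N} → NonnegCyclesBelow m → (s : Support a) → Support.r s ℕ.< m →
               (cs : Vector Constraint N) → (∀ i → cs i ∈ᶜ S) → DistinctNonzero (F-v ∘ cs) →
               linearCombination a (F-v ∘ cs) ≋ 𝟎 → ¬ ¬ (0# ≤ dot a (bound ∘ cs))
    restrict below s r<m cs cs∈S distinct balanced negative =
      below r<m (cs ∘ index) (cs∈S ∘ index)
        (distinctNonzero-reindex {V = F-v ∘ cs} index-injective distinct) numerator numerator-positive
        (λ k → trans (sym (dot-support (λ i → F-v (cs i) k))) (balanced k))
        (λ 0≤ → negative (≤-respʳ-≈ (sym (dot-support (bound ∘ cs))) 0≤))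
      where open Support s

    -- A dependent proper subfamily of negative weight is already a smaller negative cycle. One of
    -- nonnegative weight can be subtracted, leaving a negative dependence with fewer nonzero
    -- coefficients. The induction hypothesis excludes both.
    properSubfamiliesIndependent :
      ∀ {r} → NonnegCyclesBelow r → (cs : Vector Constraint r) → (∀ i → cs i ∈ᶜ S) → DistinctNonzero (F-v ∘ cs) →
      (α : Vector ℕ r) → linearCombination (fromℕ ∘ α) (F-v ∘ cs) ≋ 𝟎 → ¬ (0# ≤ dot (fromℕ ∘ α) (bound ∘ cs)) →
      ProperSubfamiliesIndependent (F-v ∘ cs)
    properSubfamiliesIndependent below cs cs∈S distinct α balanced negative ι ι-injective 0<s s<r (β , β-positive , β-balanced)
      with 0# ≤? dot (fromℕ ∘ β) (bound ∘ cs ∘ ι)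
    ... | no β-negative = below s<r (cs ∘ ι) (cs∈S ∘ ι)
            (distinctNonzero-reindex {V = F-v ∘ cs} ι-injective distinct) β β-positive β-balanced β-negative
    ... | yes β-nonneg
      with subtract {V = F-v ∘ cs} {bound ∘ cs} {α} balanced negative ι-injective 0<s β-positive β-balanced β-nonneg
    ...   | γ , γ-isNat , (i , γi≈0) , γ-balanced , γ-negative =
      restrict below s (Support.null⇒smaller s i γi≈0) cs cs∈S distinct γ-balanced γ-negative
      where s = support γ-isNat

    positive⇒nonneg : (C : HyperCycle) → let open HyperCycle C in
                      (∀ i → constraints i ∈ᶜ S) → IsPositive S C → 0# ≤ dot (fromℕ ∘ α) (bound ∘ constraints)
    positive⇒nonneg C cs∈S (w , w-min , 0≤w) = [≤]-injective (≤±-trans ≤-trans 0≤w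
      (≡.subst (weightedSum (fromℕ ∘ α) w ≤±_) (weightedSum-[] (fromℕ ∘ α) (λ _ → ≡.refl))
        (weightedSum-mono-≤± (fromℕ-nonneg ∘ α) (λ i → minWeight≤bound S (proj₂ distinct i) (cs∈S i) (w-min i)))))
      where open HyperCycle C

    -- Strong induction on the number of constraints: if all smaller cycles are nonnegative, a
    -- negative one is simple, hence positive by assumption, and its bounds dominate its minimum
    -- weights.
    nonnegCyclesBelow : ∀ m → NonnegCyclesBelow m
    nonnegCyclesBelow (suc m) {zero}      _          cs cs∈S distinct α α-positive balanced negative = negative ≤-refl
    nonnegCyclesBelow (suc m) {r@(suc _)} (s≤s r≤m) cs cs∈S distinct α α-positive balanced negative =
      negative (positive⇒nonneg C cs∈S (positive-cycles C simple))
      where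
      C : HyperCycle
      C = record
        { r>0 = s≤s z≤n ; constraints = cs ; distinct = distinct
        ; α = α ; α-positive = α-positive ; balanced = balanced }

      simple : IsSimple C
      simple = properSubfamiliesIndependent (λ q<r → nonnegCyclesBelow m (ℕ.<-≤-trans q<r r≤m))
                 cs cs∈S distinct α balanced negative

    nonnegCycles : ∀ {N} (cs : Vector Constraint N) → (∀ i → cs i ∈ᶜ S) → DistinctNonzero (F-v ∘ cs) →
                   {a : Vector Carrier N} → (∀ i → IsNat (a i)) → linearCombination a (F-v ∘ cs) ≋ 𝟎 →
                   0# ≤ dot a (bound ∘ cs)
    nonnegCycles cs cs∈S distinct {a} a-isNat balanced = decidable-stable (0# ≤? dot a (bound ∘ cs))
      (restrict (nonnegCyclesBelow _) (support a-isNat) ℕ.≤-refl cs cs∈S distinct balanced)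

  -- The two directions of the equivalence

  satisfiable⇒positive : ∀ {S} → DegenerateConstraintsHold S → Satisfiable (D S) → ∀ C → IsPositive S C
  satisfiable⇒positive {S} degenerate (ν , ν∈D) C = w , (λ i → proj₁ (proj₂ (weight i))) ,
    -- By balance, 0 is the weighted sum of the values of the normal vectors at `ν`, and each value
    -- is at most the corresponding minimum weight.
    ≤±-trans ≤-trans (≤±-reflexive ≤-reflexive [ sym (dot-balanced (fromℕ ∘ α) (F-v ∘ constraints) ν balanced) ]≈)
      (≡.subst (_≤± weightedSum (fromℕ ∘ α) w) (weightedSum-[] (fromℕ ∘ α) (λ _ → ≡.refl))
        (weightedSum-mono-≤± (fromℕ-nonneg ∘ α) (λ i → proj₂ (proj₂ (weight i)))))
    where
    open HyperCycle C
    R = reduce S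

    weight : ∀ i → ∃ λ v → MinWeight S (constraints i) v × [ dot (F-v (constraints i)) ν ] ≤± v
    weight i with constraints i ∈ᶜ? S
    ... | no  c∉S = ⊤± , outside c∉S , _ ≤⊤±
    ... | yes c∈S with LeastPath.minimum R degenerate ν∈D c∈S (proj₂ distinct i) (eliminate _ (rowsFor-isInt R (constraints i)))
    ...   | v , v-min , bounds = v , inside c∈S v-min , bounds ν∈D

    w = proj₁ ∘ weight

  positive⇒satisfiable : ∀ {S} → DegenerateConstraintsHold S →
                         (∀ C → IsSimple C → IsPositive S C) → Satisfiable (D S)
  positive⇒satisfiable {S} degenerate positive-cycles = proj₁ solution , reduced-solution R degenerate (proj₂ solution)
    where
    R = reduce S
    open Reduction R
    open Elimination (eliminate (F-v ∘ tightest) (normalVector-isInt ∘ shape ∘ tightest))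
    solution = complete (bound ∘ tightest)
      -- Each elimination multiplier is a natural dependence among the normal vectors, so its
      -- validity condition is the nonnegativity of a cycle weight.
      (λ j → NegativeCycles.nonnegCycles S positive-cycles tightest member distinct (isNat j) (annihilates j))

theorem6 : ∀ {c ℓ₁ ℓ₂} (T : OrderedField c ℓ₁ ℓ₂) → IsRealOrRational T →
    (n : ℕ) → let open FourCSP T n in
    (S : 4-CSP) → Bounded S → DegenerateConstraintsHold S →
    Satisfiable (D S) ⇔ (∀ (C : HyperCycle) → IsSimple C → IsPositive S C)
theorem6 T _ n S _ degenerate = mk⇔
  (λ satisfiable C _ → satisfiable⇒positive degenerate satisfiable C)
  (positive⇒satisfiable degenerate)
  where open FourCSPProperties T n
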